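{- Let $\Sigma$ be a set of generators. A cospan $m\to F\leftarrow n$ in $\mathsf{Csp}_D(\mathbf{Hyp}_\Sigma)$ is in the image of $\langle\!\langle-\rangle\!\rangle_\Sigma\circ\lfloor-\rfloor_\Sigma\colon\mathbf T_\Sigma+\mathbf{CComon}\to\mathsf{Csp}_D(\mathbf{Hyp}_\Sigma)$ if and only if it is partial left-monogamous.
   Context: A set of generators $\Sigma$ has functions $\mathrm{dom},\mathrm{cod}\colon\Sigma\to\mathbb N$. $\mathbf{CComon}$ is the PROP of cocommutative comonoids (generators a comultiplication $1\to2$ and counit $1\to0$, with counitality, coassociativity and cocommutativity). $\mathbf T_\Sigma+\mathbf{CComon}$ is the symmetric traced PROP freely generated by $\Sigma$ together with the comonoid generators, modulo the comonoid equations. A hypergraph $F$ has a set of vertices $F_\star$ and, for $k,l\in\mathbb N$, a set $F_{k,l}$ of hyperedges with ordered lists of $k$ sources and $l$ targets; homomorphisms preserve ordered sources and targets. $\mathbf{Hyp}_\Sigma$ is the category of finite hypergraphs in which every hyperedge is labelled by a generator of $\Sigma$ of matching arity and coarity, with label-preserving homomorphisms. Write $n$ also for the discrete hypergraph with vertices $0,\dots,n-1$ and no edges. $\mathsf{Csp}_D(\mathbf{Hyp}_\Sigma)$ is the PROP whose morphisms $m\to n$ are isomorphism classes of cospans $m\to F\leftarrow n$ in $\mathbf{Hyp}_\Sigma$, composed by pushout, with tensor by coproduct. It is self-dual compact closed, with cup $0\to n\xleftarrow{[\mathrm{id},\mathrm{id}]}n+n$ and cap $n+n\xrightarrow{[\mathrm{id},\mathrm{id}]}n\leftarrow0$;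 its canonical trace sends $x+m\to F\leftarrow x+n$ to $m\to F'\leftarrow n$, where $F'$ is $F$ with the $a$-th input vertex and $a$-th output vertex merged for each $a<x$. $\lfloor-\rfloor_\Sigma$ embeds $\mathbf T_\Sigma+\mathbf{CComon}$ into $\mathbf S_\Sigma+\mathbf{Frob}$ ($\mathbf S_\Sigma$ the PROP freely generated over $\Sigma$, $\mathbf{Frob}$ the PROP of special commutative Frobenius algebras), the comonoid going to the comonoid of $\mathbf{Frob}$ and the trace to the canonical trace built from the Frobenius structure; $\langle\!\langle-\rangle\!\rangle_\Sigma\colon\mathbf S_\Sigma+\mathbf{Frob}\to\mathsf{Csp}_D(\mathbf{Hyp}_\Sigma)$ is the PROP morphism sending $\phi\in\Sigma$, $\phi\colon k\to l$, to the cospan $k\to E_\phi\leftarrow l$ with a single $\phi$-labelled hyperedge with $k+l$ distinct source and target vertices, picked in order by the legs, and the Frobenius generators $a\to b$ to the cospans $a\to1\leftarrow b$ with a single vertex. The degree of a vertex $v$ is $(i,o)$, with $i$ the number of hyperedge target positions and $o$ the number of hyperedge source positions occupied by $v$. A cospan $m\xrightarrow{f}F\xleftarrow{g}n$ is partial left-monogamous if $f$ is mono and every vertex $v$ has degree $(0,o)$ if $v$ is in the image of $f$, and $(0,o)$ or $(1,o)$ otherwise, for some $o\in\mathbb N$. -}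

module Defs where

open import Level using (0ℓ)
open import Data.Nat using (ℕ; zero; suc; _+_)
open import Data.Nat.Properties using (+-assoc; +-identityʳ)
open import Data.Fin using (Fin; zero; suc; _↑ˡ_; _↑ʳ_; splitAt; join; punchIn; punchOut)
open import Data.Fin.Properties
  using (_≟_; splitAt-↑ˡ; splitAt-↑ʳ; join-splitAt; punchInᵢ≢i; punchIn-punchOut; punchOut-punchIn; punchOut-cong)
open import Data.Vec using (Vec; toList; tabulate; count; sum)
import Data.Vec as Vec
open import Data.Vec.Properties using (toList-map)
import Data.List as List
open import Data.List.Properties using (map-id; map-∘; map-cong)
open import Data.Product using (∃-syntax; _×_; _,_; proj₁; proj₂)
open import Data.Sum using (_⊎_; inj₁; inj₂; [_,_]′; swap)
open import Function using (_∘_)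
open import Relation.Nullary using (¬_; yes; no; contradiction)
open import Relation.Binary.Bundles using (Setoid)
open import Relation.Binary.PropositionalEquality
  using (_≡_; _≢_; _≗_; refl; sym; trans; cong; subst; subst₂)

record Signature : Set₁ where
  field
    Gen     : Set
    dom cod : Gen → ℕ

-- The operations of a PROP.  Since + on ℕ is associative and unital only
-- propositionally, strictness is expressed below by transporting
-- morphisms along equalities of their objects.
record PROPOps : Set₁ where
  infixr 7 _⨾_
  infixr 8 _⊗_
  field
    Hom : ℕ → ℕ → Set
    id  : ∀ n → Hom n n
    _⨾_ : ∀ {l m n} → Hom l m → Hom m n → Hom l n
    _⊗_ : ∀ {m n p q} → Hom m n → Hom p q → Hom (m + p) (n + q)
    σ   : ∀ m n → Hom (m + n) (n + m)

  cast : ∀ {m m′ n n′} → m ≡ m′ → n ≡ n′ → Hom m n → Hom m′ n′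
  cast = subst₂ Hom

module _ (P : PROPOps) where
  open PROPOps P

  data PROPLaw : ∀ {m n} → Hom m n → Hom m n → Set where
    ⨾-identityˡ : ∀ {m n} (f : Hom m n) → PROPLaw (id m ⨾ f) f
    ⨾-identityʳ : ∀ {m n} (f : Hom m n) → PROPLaw (f ⨾ id n) f
    ⨾-assoc     : ∀ {k l m n} (f : Hom k l) (g : Hom l m) (h : Hom m n) →
                  PROPLaw ((f ⨾ g) ⨾ h) (f ⨾ (g ⨾ h))
    ⊗-id        : ∀ m n → PROPLaw (id m ⊗ id n) (id (m + n))
    interchange : ∀ {l m n p q r} (f : Hom l m) (g : Hom m n) (h : Hom p q) (k : Hom q r) →
                  PROPLaw ((f ⨾ g) ⊗ (h ⨾ k)) ((f ⊗ h) ⨾ (g ⊗ k))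
    ⊗-identityˡ : ∀ {m n} (f : Hom m n) → PROPLaw (id 0 ⊗ f) f
    ⊗-identityʳ : ∀ {m n} (f : Hom m n) →
                  PROPLaw (cast (+-identityʳ m) (+-identityʳ n) (f ⊗ id 0)) f
    ⊗-assoc     : ∀ {m n p q r s} (f : Hom m n) (g : Hom p q) (h : Hom r s) →
                  PROPLaw (cast (+-assoc m p r) (+-assoc n q s) ((f ⊗ g) ⊗ h)) (f ⊗ (g ⊗ h))
    σ-natural   : ∀ {m n p q} (f : Hom m n) (g : Hom p q) →
                  PROPLaw ((f ⊗ g) ⨾ σ n q) (σ m p ⨾ (g ⊗ f))
    σ-involutive : ∀ m n → PROPLaw (σ m n ⨾ σ n m) (id (m + n))
    σ-hexagon   : ∀ m n p →
                  PROPLaw (cast (sym (+-assoc m n p)) (+-assoc n p m) (σ m (n + p)))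
                          ((σ m n ⊗ id p) ⨾
                           cast (sym (+-assoc n m p)) refl (id n ⊗ σ m p))

  data TraceLaw (tr : ∀ x {m n} → Hom (x + m) (x + n) → Hom m n) :
       ∀ {m n} → Hom m n → Hom m n → Set where
    tightening  : ∀ x {m m′ n n′} (g : Hom m m′) (f : Hom (x + m′) (x + n)) (h : Hom n n′) →
                  TraceLaw tr (tr x ((id x ⊗ g) ⨾ f ⨾ (id x ⊗ h))) (g ⨾ tr x f ⨾ h)
    superposing : ∀ x {m n p q} (f : Hom (x + m) (x + n)) (g : Hom p q) →
                  TraceLaw tr (tr x (cast (+-assoc x m p) (+-assoc x n q) (f ⊗ g))) (tr x f ⊗ g)
    sliding     : ∀ x y {m n} (f : Hom (x + m) (y + n)) (g : Hom y x) →
                  TraceLaw tr (tr x (f ⨾ (g ⊗ id n))) (tr y ((g ⊗ id m) ⨾ f))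
    vanishing-0 : ∀ {m n} (f : Hom m n) → TraceLaw tr (tr 0 f) f
    vanishing-+ : ∀ x y {m n} (f : Hom (x + (y + m)) (x + (y + n))) →
                  TraceLaw tr (tr (x + y) (cast (sym (+-assoc x y m)) (sym (+-assoc x y n)) f))
                              (tr y (tr x f))
    yanking     : ∀ x → TraceLaw tr (tr x (σ x x)) (id x)

  data ComonoidLaw (δ : Hom 1 2) (ε : Hom 1 0) : ∀ {m n} → Hom m n → Hom m n → Set where
    counitˡ       : ComonoidLaw δ ε (δ ⨾ (ε ⊗ id 1)) (id 1)
    counitʳ       : ComonoidLaw δ ε (δ ⨾ (id 1 ⊗ ε)) (id 1)
    coassociative : ComonoidLaw δ ε (δ ⨾ (δ ⊗ id 1)) (δ ⨾ (id 1 ⊗ δ))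
    cocommutative : ComonoidLaw δ ε (δ ⨾ σ 1 1) δ

  data FrobeniusLaw (μ : Hom 2 1) (η : Hom 0 1) (δ : Hom 1 2) (ε : Hom 1 0) :
       ∀ {m n} → Hom m n → Hom m n → Set where
    unitˡ       : FrobeniusLaw μ η δ ε ((η ⊗ id 1) ⨾ μ) (id 1)
    unitʳ       : FrobeniusLaw μ η δ ε ((id 1 ⊗ η) ⨾ μ) (id 1)
    associative : FrobeniusLaw μ η δ ε ((μ ⊗ id 1) ⨾ μ) ((id 1 ⊗ μ) ⨾ μ)
    commutative : FrobeniusLaw μ η δ ε (σ 1 1 ⨾ μ) μ
    comonoid    : ∀ {m n} {f g : Hom m n} → ComonoidLaw δ ε f g → FrobeniusLaw μ η δ ε f g
    frobeniusˡ  : FrobeniusLaw μ η δ ε ((δ ⊗ id 1) ⨾ (id 1 ⊗ μ)) (μ ⨾ δ)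
    frobeniusʳ  : FrobeniusLaw μ η δ ε ((id 1 ⊗ δ) ⨾ (μ ⊗ id 1)) (μ ⨾ δ)
    special     : FrobeniusLaw μ η δ ε (δ ⨾ μ) (id 1)

  -- The Frobenius structure extends from 1 to every n by tensoring n copies
  -- and interleaving the wires, which makes n self-dual via ηs n ⨾ δs n and
  -- μs n ⨾ εs n.
  module CanonicalTrace (μ : Hom 2 1) (η : Hom 0 1) (δ : Hom 1 2) (ε : Hom 1 0) where

    ηs : ∀ n → Hom 0 n
    ηs zero    = id 0
    ηs (suc n) = η ⊗ ηs n

    εs : ∀ n → Hom n 0
    εs zero    = id 0
    εs (suc n) = ε ⊗ εs n

    δs : ∀ n → Hom n (n + n)
    δs zero    = id 0
    δs (suc n) = (δ ⊗ δs n) ⨾ cast refl (cong suc (+-assoc n 1 n)) (id 1 ⊗ (σ 1 n ⊗ id n))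

    μs : ∀ n → Hom (n + n) n
    μs zero    = id 0
    μs (suc n) = cast (cong suc (+-assoc n 1 n)) refl (id 1 ⊗ (σ n 1 ⊗ id n)) ⨾ (μ ⊗ μs n)

    cup : ∀ n → Hom 0 (n + n)
    cup n = ηs n ⨾ δs n

    cap : ∀ n → Hom (n + n) 0
    cap n = μs n ⨾ εs n

    canonicalTrace : ∀ x {m n} → Hom (x + m) (x + n) → Hom m n
    canonicalTrace x {m} {n} f =
      cast refl (+-assoc x x m) (cup x ⊗ id m) ⨾
      (id x ⊗ f) ⨾
      cast (+-assoc x x n) refl (cap x ⊗ id n)

-- proj has the section rep, so a map out of the quotient is a map h on
-- representatives; descend says that every compatible h factors through proj.
record Coequaliser {k N : ℕ} (u v : Fin k → Fin N) : Set₁ where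
  field
    size     : ℕ
    proj     : Fin N → Fin size
    coequal  : proj ∘ u ≗ proj ∘ v
    rep      : Fin size → Fin N
    proj-rep : ∀ y → proj (rep y) ≡ y
    descend  : ∀ {A : Set} (h : Fin N → A) → h ∘ u ≗ h ∘ v → ∀ x → h (rep (proj x)) ≡ h x

private
  glue : ∀ {N} (a b : Fin N) → Coequaliser {1} (λ _ → a) (λ _ → b)
  glue {N} a b with a ≟ b
  glue {N} a .a | yes refl = record
    { size     = N
    ; proj     = λ x → x
    ; coequal  = λ _ → refl
    ; rep      = λ x → x
    ; proj-rep = λ _ → refl
    ; descend  = λ _ _ _ → refl
    }
  glue {suc N} a b | no a≢b = record
    { size     = N
    ; proj     = proj
    ; coequal  = λ _ → trans (proj-≢ a≢b) (sym proj-b)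
    ; rep      = punchIn b
    ; proj-rep = λ y → trans (proj-≢ (punchInᵢ≢i b y))
                             (trans (punchOut-cong b refl) (punchOut-punchIn b))
    ; descend  = descend
    }
    where
    proj : Fin (suc N) → Fin N
    proj x with x ≟ b
    ... | yes _   = punchOut (a≢b ∘ sym)
    ... | no  x≢b = punchOut (x≢b ∘ sym)

    proj-b : proj b ≡ punchOut (a≢b ∘ sym)
    proj-b with b ≟ b
    ... | yes _   = refl
    ... | no  b≢b = contradiction refl b≢b

    proj-≢ : ∀ {x} (x≢b : x ≢ b) → proj x ≡ punchOut (x≢b ∘ sym)
    proj-≢ {x} x≢b with x ≟ b
    ... | yes x≡b = contradiction x≡b x≢b
    ... | no  _   = punchOut-cong b refl

    descend : ∀ {A : Set} (h : Fin (suc N) → A) → (∀ _ → h a ≡ h b) →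
              ∀ x → h (punchIn b (proj x)) ≡ h x
    descend h ha≡hb x with x ≟ b
    ... | yes x≡b = trans (cong h (punchIn-punchOut (a≢b ∘ sym)))
                          (trans (ha≡hb (zero {0})) (cong h (sym x≡b)))
    ... | no  x≢b = cong h (punchIn-punchOut (x≢b ∘ sym))

coequaliser : ∀ {k N} (u v : Fin k → Fin N) → Coequaliser u v
coequaliser {zero} {N} u v = record
  { size     = N
  ; proj     = λ x → x
  ; coequal  = λ ()
  ; rep      = λ x → x
  ; proj-rep = λ _ → refl
  ; descend  = λ _ _ _ → refl
  }
coequaliser {suc k} u v = record
  { size     = R.size
  ; proj     = R.proj ∘ G.proj
  ; coequal  = λ { zero    → cong R.proj (G.coequal zero)
                 ; (suc i) → R.coequal i }
  ; rep      = G.rep ∘ R.rep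
  ; proj-rep = λ y → trans (cong R.proj (G.proj-rep (R.rep y))) (R.proj-rep y)
  ; descend  = λ h hu≗hv x →
      let down  = G.descend h (λ { zero → hu≗hv zero })
          down′ = R.descend (h ∘ G.rep) (λ i →
                    trans (down (u (suc i))) (trans (hu≗hv (suc i)) (sym (down (v (suc i))))))
      in trans (down′ (G.proj x)) (down x)
  }
  where
  module G = Coequaliser (glue (u zero) (v zero))
  module R = Coequaliser (coequaliser (G.proj ∘ u ∘ suc) (G.proj ∘ v ∘ suc))

module Over (𝕊 : Signature) where
  open Signature 𝕊

  infixr 7 _⨾_
  infixr 8 _⊗_
  infix  4 _≈ᵀ_ _≈ˢ_

  data TTerm : ℕ → ℕ → Set where
    gen : (φ : Gen) → TTerm (dom φ) (cod φ)
    δ   : TTerm 1 2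
    ε   : TTerm 1 0
    id  : ∀ n → TTerm n n
    _⨾_ : ∀ {l m n} → TTerm l m → TTerm m n → TTerm l n
    _⊗_ : ∀ {m n p q} → TTerm m n → TTerm p q → TTerm (m + p) (n + q)
    σ   : ∀ m n → TTerm (m + n) (n + m)
    tr  : ∀ x {m n} → TTerm (x + m) (x + n) → TTerm m n

  data STerm : ℕ → ℕ → Set where
    gen : (φ : Gen) → STerm (dom φ) (cod φ)
    μ   : STerm 2 1
    η   : STerm 0 1
    δ   : STerm 1 2
    ε   : STerm 1 0
    id  : ∀ n → STerm n n
    _⨾_ : ∀ {l m n} → STerm l m → STerm m n → STerm l n
    _⊗_ : ∀ {m n p q} → STerm m n → STerm p q → STerm (m + p) (n + q)
    σ   : ∀ m n → STerm (m + n) (n + m)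

  TOps : PROPOps
  TOps = record { Hom = TTerm ; id = id ; _⨾_ = _⨾_ ; _⊗_ = _⊗_ ; σ = σ }

  SOps : PROPOps
  SOps = record { Hom = STerm ; id = id ; _⨾_ = _⨾_ ; _⊗_ = _⊗_ ; σ = σ }

  data _≈ᵀ_ : ∀ {m n} → TTerm m n → TTerm m n → Set where
    ≈-refl   : ∀ {m n} {f : TTerm m n} → f ≈ᵀ f
    ≈-sym    : ∀ {m n} {f g : TTerm m n} → f ≈ᵀ g → g ≈ᵀ f
    ≈-trans  : ∀ {m n} {f g h : TTerm m n} → f ≈ᵀ g → g ≈ᵀ h → f ≈ᵀ h
    ⨾-cong   : ∀ {l m n} {f f′ : TTerm l m} {g g′ : TTerm m n} →
               f ≈ᵀ f′ → g ≈ᵀ g′ → f ⨾ g ≈ᵀ f′ ⨾ g′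
    ⊗-cong   : ∀ {m n p q} {f f′ : TTerm m n} {g g′ : TTerm p q} →
               f ≈ᵀ f′ → g ≈ᵀ g′ → f ⊗ g ≈ᵀ f′ ⊗ g′
    tr-cong  : ∀ x {m n} {f f′ : TTerm (x + m) (x + n)} → f ≈ᵀ f′ → tr x f ≈ᵀ tr x f′
    prop     : ∀ {m n} {f g : TTerm m n} → PROPLaw TOps f g → f ≈ᵀ g
    trace    : ∀ {m n} {f g : TTerm m n} → TraceLaw TOps tr f g → f ≈ᵀ g
    comonoid : ∀ {m n} {f g : TTerm m n} → ComonoidLaw TOps δ ε f g → f ≈ᵀ g

  data _≈ˢ_ : ∀ {m n} → STerm m n → STerm m n → Set where
    ≈-refl    : ∀ {m n} {f : STerm m n} → f ≈ˢ f
    ≈-sym     : ∀ {m n} {f g : STerm m n} → f ≈ˢ g → g ≈ˢ f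
    ≈-trans   : ∀ {m n} {f g h : STerm m n} → f ≈ˢ g → g ≈ˢ h → f ≈ˢ h
    ⨾-cong    : ∀ {l m n} {f f′ : STerm l m} {g g′ : STerm m n} →
                f ≈ˢ f′ → g ≈ˢ g′ → f ⨾ g ≈ˢ f′ ⨾ g′
    ⊗-cong    : ∀ {m n p q} {f f′ : STerm m n} {g g′ : STerm p q} →
                f ≈ˢ f′ → g ≈ˢ g′ → f ⊗ g ≈ˢ f′ ⊗ g′
    prop      : ∀ {m n} {f g : STerm m n} → PROPLaw SOps f g → f ≈ˢ g
    frobenius : ∀ {m n} {f g : STerm m n} → FrobeniusLaw SOps μ η δ ε f g → f ≈ˢ g

  T+CComon : ℕ → ℕ → Setoid 0ℓ 0ℓ
  T+CComon m n = record
    { Carrier       = TTerm m n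
    ; _≈_           = _≈ᵀ_
    ; isEquivalence = record { refl = ≈-refl ; sym = ≈-sym ; trans = ≈-trans }
    }

  S+Frob : ℕ → ℕ → Setoid 0ℓ 0ℓ
  S+Frob m n = record
    { Carrier       = STerm m n
    ; _≈_           = _≈ˢ_
    ; isEquivalence = record { refl = ≈-refl ; sym = ≈-sym ; trans = ≈-trans }
    }

  ⌊_⌋ : ∀ {m n} → TTerm m n → STerm m n
  ⌊ gen φ ⌋  = gen φ
  ⌊ δ ⌋      = δ
  ⌊ ε ⌋      = ε
  ⌊ id n ⌋   = id n
  ⌊ f ⨾ g ⌋  = ⌊ f ⌋ ⨾ ⌊ g ⌋
  ⌊ f ⊗ g ⌋  = ⌊ f ⌋ ⊗ ⌊ g ⌋
  ⌊ σ m n ⌋  = σ m n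
  ⌊ tr x f ⌋ = CanonicalTrace.canonicalTrace SOps μ η δ ε x ⌊ f ⌋

  -- Finite Σ-labelled hypergraphs, on skeletal sets of vertices and edges.
  -- The hyperedges in F_{k,l} are those whose label has arity k and coarity l.
  record Hypergraph : Set where
    field
      vertices edges : ℕ
      label          : Fin edges → Gen
      sources        : ∀ e → Vec (Fin vertices) (dom (label e))
      targets        : ∀ e → Vec (Fin vertices) (cod (label e))

  open Hypergraph public

  infix 3 _⇒_
  infix 4 _≈ₕ_
  infixr 9 _∘ₕ_

  record _⇒_ (F G : Hypergraph) : Set where
    field
      vmap         : Fin (vertices F) → Fin (vertices G)
      emap         : Fin (edges F) → Fin (edges G)
      pres-label   : ∀ e → label G (emap e) ≡ label F e
      pres-sources : ∀ e → toList (sources G (emap e)) ≡ List.map vmap (toList (sources F e))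
      pres-targets : ∀ e → toList (targets G (emap e)) ≡ List.map vmap (toList (targets F e))

  open _⇒_ public

  _≈ₕ_ : ∀ {F G} → (F ⇒ G) → (F ⇒ G) → Set
  h ≈ₕ k = (vmap h ≗ vmap k) × (emap h ≗ emap k)

  idₕ : ∀ {F} → F ⇒ F
  idₕ = record
    { vmap         = λ v → v
    ; emap         = λ e → e
    ; pres-label   = λ _ → refl
    ; pres-sources = λ _ → sym (map-id _)
    ; pres-targets = λ _ → sym (map-id _)
    }

  _∘ₕ_ : ∀ {F G H} → (G ⇒ H) → (F ⇒ G) → (F ⇒ H)
  k ∘ₕ h = record
    { vmap         = vmap k ∘ vmap h
    ; emap         = emap k ∘ emap h
    ; pres-label   = λ e → trans (pres-label k (emap h e)) (pres-label h e)
    ; pres-sources = λ e → trans (pres-sources k (emap h e))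
                      (trans (cong (List.map (vmap k)) (pres-sources h e)) (sym (map-∘ _)))
    ; pres-targets = λ e → trans (pres-targets k (emap h e))
                      (trans (cong (List.map (vmap k)) (pres-targets h e)) (sym (map-∘ _)))
    }

  Mono : ∀ {F G} → (F ⇒ G) → Set
  Mono {F} h = ∀ {X} (j k : X ⇒ F) → h ∘ₕ j ≈ₕ h ∘ₕ k → j ≈ₕ k

  discrete : ℕ → Hypergraph
  discrete n = record
    { vertices = n ; edges = 0 ; label = λ () ; sources = λ () ; targets = λ () }

  fromDiscrete : ∀ {n F} → (Fin n → Fin (vertices F)) → discrete n ⇒ F
  fromDiscrete f = record
    { vmap = f ; emap = λ () ; pres-label = λ () ; pres-sources = λ () ; pres-targets = λ () }

  module _ (F G : Hypergraph) where
    private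
      V = Fin (vertices F + vertices G)
      E = Fin (edges F) ⊎ Fin (edges G)

      label⊕ : E → Gen
      label⊕ = [ label F , label G ]′

      sources⊕ : ∀ (e : E) → Vec V (dom (label⊕ e))
      sources⊕ (inj₁ e) = Vec.map (_↑ˡ vertices G) (sources F e)
      sources⊕ (inj₂ e) = Vec.map (vertices F ↑ʳ_) (sources G e)

      targets⊕ : ∀ (e : E) → Vec V (cod (label⊕ e))
      targets⊕ (inj₁ e) = Vec.map (_↑ˡ vertices G) (targets F e)
      targets⊕ (inj₂ e) = Vec.map (vertices F ↑ʳ_) (targets G e)

    infixr 6 _⊕_

    _⊕_ : Hypergraph
    _⊕_ = record
      { vertices = vertices F + vertices G
      ; edges    = edges F + edges G
      ; label    = label⊕ ∘ splitAt (edges F)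
      ; sources  = sources⊕ ∘ splitAt (edges F)
      ; targets  = targets⊕ ∘ splitAt (edges F)
      }

    inl : F ⇒ _⊕_
    inl = record
      { vmap         = _↑ˡ vertices G
      ; emap         = _↑ˡ edges G
      ; pres-label   = λ e → cong label⊕ (splitAt-↑ˡ (edges F) e (edges G))
      ; pres-sources = λ e → trans (cong (toList ∘ sources⊕) (splitAt-↑ˡ (edges F) e (edges G)))
                                   (toList-map _ (sources F e))
      ; pres-targets = λ e → trans (cong (toList ∘ targets⊕) (splitAt-↑ˡ (edges F) e (edges G)))
                                   (toList-map _ (targets F e))
      }

    inr : G ⇒ _⊕_
    inr = record
      { vmap         = vertices F ↑ʳ_
      ; emap         = edges F ↑ʳ_
      ; pres-label   = λ e → cong label⊕ (splitAt-↑ʳ (edges F) (edges G) e)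
      ; pres-sources = λ e → trans (cong (toList ∘ sources⊕) (splitAt-↑ʳ (edges F) (edges G) e))
                                   (toList-map _ (sources G e))
      ; pres-targets = λ e → trans (cong (toList ∘ targets⊕) (splitAt-↑ʳ (edges F) (edges G) e))
                                   (toList-map _ (targets G e))
      }

    module _ {X : Hypergraph} (h : F ⇒ X) (k : G ⇒ X) where
      private
        vm : V → Fin (vertices X)
        vm = [ vmap h , vmap k ]′ ∘ splitAt (vertices F)

        em : E → Fin (edges X)
        em = [ emap h , emap k ]′

        vm-inl : ∀ {n} (xs : Vec (Fin (vertices F)) n) →
                 List.map vm (toList (Vec.map (_↑ˡ vertices G) xs)) ≡ List.map (vmap h) (toList xs)
        vm-inl xs = trans (cong (List.map vm) (toList-map _ xs))
          (trans (sym (map-∘ (toList xs)))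
                 (map-cong (λ v → cong [ vmap h , vmap k ]′ (splitAt-↑ˡ _ v _)) (toList xs)))

        vm-inr : ∀ {n} (xs : Vec (Fin (vertices G)) n) →
                 List.map vm (toList (Vec.map (vertices F ↑ʳ_) xs)) ≡ List.map (vmap k) (toList xs)
        vm-inr xs = trans (cong (List.map vm) (toList-map _ xs))
          (trans (sym (map-∘ (toList xs)))
                 (map-cong (λ v → cong [ vmap h , vmap k ]′ (splitAt-↑ʳ (vertices F) _ v)) (toList xs)))

        pl : ∀ e → label X (em e) ≡ label⊕ e
        pl (inj₁ e) = pres-label h e
        pl (inj₂ e) = pres-label k e

        ps : ∀ e → toList (sources X (em e)) ≡ List.map vm (toList (sources⊕ e))
        ps (inj₁ e) = trans (pres-sources h e) (sym (vm-inl (sources F e)))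
        ps (inj₂ e) = trans (pres-sources k e) (sym (vm-inr (sources G e)))

        pt : ∀ e → toList (targets X (em e)) ≡ List.map vm (toList (targets⊕ e))
        pt (inj₁ e) = trans (pres-targets h e) (sym (vm-inl (targets F e)))
        pt (inj₂ e) = trans (pres-targets k e) (sym (vm-inr (targets G e)))

      copair : _⊕_ ⇒ X
      copair = record
        { vmap         = vm
        ; emap         = em ∘ splitAt (edges F)
        ; pres-label   = pl ∘ splitAt (edges F)
        ; pres-sources = ps ∘ splitAt (edges F)
        ; pres-targets = pt ∘ splitAt (edges F)
        }

  record Pushout {A F G : Hypergraph} (f : A ⇒ F) (g : A ⇒ G) : Set where
    field
      object    : Hypergraph
      i₁        : F ⇒ object
      i₂        : G ⇒ object
      commutes  : i₁ ∘ₕ f ≈ₕ i₂ ∘ₕ g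
      universal : ∀ {X} (h : F ⇒ X) (k : G ⇒ X) → h ∘ₕ f ≈ₕ k ∘ₕ g → object ⇒ X
      universal∘i₁ : ∀ {X} (h : F ⇒ X) (k : G ⇒ X) (eq : h ∘ₕ f ≈ₕ k ∘ₕ g) →
                     universal h k eq ∘ₕ i₁ ≈ₕ h
      universal∘i₂ : ∀ {X} (h : F ⇒ X) (k : G ⇒ X) (eq : h ∘ₕ f ≈ₕ k ∘ₕ g) →
                     universal h k eq ∘ₕ i₂ ≈ₕ k
      unique    : ∀ {X} (j l : object ⇒ X) →
                  j ∘ₕ i₁ ≈ₕ l ∘ₕ i₁ → j ∘ₕ i₂ ≈ₕ l ∘ₕ i₂ → j ≈ₕ l

  -- The pushout over a discrete hypergraph is the coproduct with the two
  -- images of each vertex merged.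
  module _ {n : ℕ} {F G : Hypergraph} (f : discrete n ⇒ F) (g : discrete n ⇒ G) where
    private
      module Q = Coequaliser (coequaliser ((_↑ˡ vertices G) ∘ vmap f) ((vertices F ↑ʳ_) ∘ vmap g))

      merged : Hypergraph
      merged = record
        { vertices = Q.size
        ; edges    = edges (F ⊕ G)
        ; label    = label (F ⊕ G)
        ; sources  = λ e → Vec.map Q.proj (sources (F ⊕ G) e)
        ; targets  = λ e → Vec.map Q.proj (targets (F ⊕ G) e)
        }

      merge : F ⊕ G ⇒ merged
      merge = record
        { vmap         = Q.proj
        ; emap         = λ e → e
        ; pres-label   = λ _ → refl
        ; pres-sources = λ e → toList-map Q.proj (sources (F ⊕ G) e)
        ; pres-targets = λ e → toList-map Q.proj (targets (F ⊕ G) e)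
        }

      module _ {X : Hypergraph} (h : F ⇒ X) (k : G ⇒ X) (eq : h ∘ₕ f ≈ₕ k ∘ₕ g) where
        hk : F ⊕ G ⇒ X
        hk = copair F G h k

        hk∘inl : vmap hk ∘ (_↑ˡ vertices G) ≗ vmap h
        hk∘inl v = cong [ vmap h , vmap k ]′ (splitAt-↑ˡ _ v _)

        hk∘inr : vmap hk ∘ (vertices F ↑ʳ_) ≗ vmap k
        hk∘inr v = cong [ vmap h , vmap k ]′ (splitAt-↑ʳ (vertices F) _ v)

        descends : vmap hk ∘ Q.rep ∘ Q.proj ≗ vmap hk
        descends = Q.descend (vmap hk) λ i →
          trans (hk∘inl (vmap f i)) (trans (proj₁ eq i) (sym (hk∘inr (vmap g i))))

        descends-map : ∀ {l} (xs : Vec (Fin (vertices (F ⊕ G))) l) →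
          List.map (vmap hk) (toList xs) ≡
          List.map (vmap hk ∘ Q.rep) (toList (Vec.map Q.proj xs))
        descends-map xs = sym (trans (cong (List.map (vmap hk ∘ Q.rep)) (toList-map Q.proj xs))
          (trans (sym (map-∘ (toList xs))) (map-cong descends (toList xs))))

        factor : merged ⇒ X
        factor = record
          { vmap         = vmap hk ∘ Q.rep
          ; emap         = emap hk
          ; pres-label   = pres-label hk
          ; pres-sources = λ e → trans (pres-sources hk e) (descends-map (sources (F ⊕ G) e))
          ; pres-targets = λ e → trans (pres-targets hk e) (descends-map (targets (F ⊕ G) e))
          }

      onSum : ∀ {a b} {A : Set} (p q : Fin (a + b) → A) →
              (∀ i → p (i ↑ˡ b) ≡ q (i ↑ˡ b)) → (∀ i → p (a ↑ʳ i) ≡ q (a ↑ʳ i)) → p ≗ q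
      onSum {a} {b} p q l r i =
        subst (λ j → p j ≡ q j) (join-splitAt a b i) (go (splitAt a i))
        where
        go : ∀ s → p (join a b s) ≡ q (join a b s)
        go (inj₁ j) = l j
        go (inj₂ j) = r j

    pushout : Pushout f g
    pushout = record
      { object       = merged
      ; i₁           = merge ∘ₕ inl F G
      ; i₂           = merge ∘ₕ inr F G
      ; commutes     = Q.coequal , λ ()
      ; universal    = factor
      ; universal∘i₁ = λ h k eq →
            (λ v → trans (descends h k eq (v ↑ˡ _)) (hk∘inl h k eq v))
          , (λ e → cong [ emap h , emap k ]′ (splitAt-↑ˡ _ e _))
      ; universal∘i₂ = λ h k eq →
            (λ v → trans (descends h k eq (_ ↑ʳ v)) (hk∘inr h k eq v))
          , (λ e → cong [ emap h , emap k ]′ (splitAt-↑ʳ (edges F) _ e))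
      ; unique       = λ j l e₁ e₂ →
            (λ v → subst (λ w → vmap j w ≡ vmap l w) (Q.proj-rep v)
                     (onSum (vmap j ∘ Q.proj) (vmap l ∘ Q.proj) (proj₁ e₁) (proj₁ e₂) (Q.rep v)))
          , onSum (emap j) (emap l) (proj₂ e₁) (proj₂ e₂)
      }

  record Cospan (m n : ℕ) : Set where
    constructor cospan
    field
      {apex} : Hypergraph
      left   : discrete m ⇒ apex
      right  : discrete n ⇒ apex

  open Cospan public

  infix 4 _≅_

  record _≅_ {m n} (c d : Cospan m n) : Set where
    field
      to         : apex c ⇒ apex d
      from       : apex d ⇒ apex c
      from∘to    : from ∘ₕ to ≈ₕ idₕ
      to∘from    : to ∘ₕ from ≈ₕ idₕ
      to∘left    : to ∘ₕ left c ≈ₕ left d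
      to∘right   : to ∘ₕ right c ≈ₕ right d

  ≅-refl : ∀ {m n} {c : Cospan m n} → c ≅ c
  ≅-refl = record
    { to       = idₕ
    ; from     = idₕ
    ; from∘to  = (λ _ → refl) , (λ _ → refl)
    ; to∘from  = (λ _ → refl) , (λ _ → refl)
    ; to∘left  = (λ _ → refl) , (λ ())
    ; to∘right = (λ _ → refl) , (λ ())
    }

  ≅-sym : ∀ {m n} {c d : Cospan m n} → c ≅ d → d ≅ c
  ≅-sym p = record
    { to       = from
    ; from     = to
    ; from∘to  = to∘from
    ; to∘from  = from∘to
    ; to∘left  = (λ i → trans (cong (vmap from) (sym (proj₁ to∘left i))) (proj₁ from∘to _)) , (λ ())
    ; to∘right = (λ i → trans (cong (vmap from) (sym (proj₁ to∘right i))) (proj₁ from∘to _)) , (λ ())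
    }
    where open _≅_ p

  ≅-trans : ∀ {m n} {b c d : Cospan m n} → b ≅ c → c ≅ d → b ≅ d
  ≅-trans p q = record
    { to       = Q.to ∘ₕ P.to
    ; from     = P.from ∘ₕ Q.from
    ; from∘to  = (λ v → trans (cong (vmap P.from) (proj₁ Q.from∘to _)) (proj₁ P.from∘to v))
               , (λ e → trans (cong (emap P.from) (proj₂ Q.from∘to _)) (proj₂ P.from∘to e))
    ; to∘from  = (λ v → trans (cong (vmap Q.to) (proj₁ P.to∘from _)) (proj₁ Q.to∘from v))
               , (λ e → trans (cong (emap Q.to) (proj₂ P.to∘from _)) (proj₂ Q.to∘from e))
    ; to∘left  = (λ i → trans (cong (vmap Q.to) (proj₁ P.to∘left i)) (proj₁ Q.to∘left i)) , (λ ())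
    ; to∘right = (λ i → trans (cong (vmap Q.to) (proj₁ P.to∘right i)) (proj₁ Q.to∘right i)) , (λ ())
    }
    where
    module P = _≅_ p
    module Q = _≅_ q

  Csp : ℕ → ℕ → Setoid 0ℓ 0ℓ
  Csp m n = record
    { Carrier       = Cospan m n
    ; _≈_           = _≅_
    ; isEquivalence = record { refl = ≅-refl ; sym = ≅-sym ; trans = ≅-trans }
    }

  idᶜ : ∀ n → Cospan n n
  idᶜ n = cospan idₕ idₕ

  _⨾ᶜ_ : ∀ {l m n} → Cospan l m → Cospan m n → Cospan l n
  c ⨾ᶜ d = cospan (i₁ ∘ₕ left c) (i₂ ∘ₕ right d)
    where open Pushout (pushout (right c) (left d))

  -- The two coproduct legs are joined along m + p ≅ discrete m ⊕ discrete p.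
  _⊗ᶜ_ : ∀ {m n p q} → Cospan m n → Cospan p q → Cospan (m + p) (n + q)
  c ⊗ᶜ d = cospan (legs (left c) (left d)) (legs (right c) (right d))
    where
    legs : ∀ {a b} → discrete a ⇒ apex c → discrete b ⇒ apex d →
           discrete (a + b) ⇒ apex c ⊕ apex d
    legs {a} {b} f g = fromDiscrete
      (vmap (copair (discrete a) (discrete b) (inl (apex c) (apex d) ∘ₕ f) (inr (apex c) (apex d) ∘ₕ g)))

  -- Output j and input i meet in the same vertex when they name the same
  -- element of m ⊎ n.
  σᶜ : ∀ m n → Cospan (m + n) (n + m)
  σᶜ m n = cospan idₕ (fromDiscrete (join m n ∘ swap ∘ splitAt n))

  E[_] : Gen → Hypergraph
  E[ φ ] = record
    { vertices = dom φ + cod φ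
    ; edges    = 1
    ; label    = λ _ → φ
    ; sources  = λ _ → tabulate (_↑ˡ cod φ)
    ; targets  = λ _ → tabulate (dom φ ↑ʳ_)
    }

  genᶜ : (φ : Gen) → Cospan (dom φ) (cod φ)
  genᶜ φ = cospan {apex = E[ φ ]} (fromDiscrete (_↑ˡ cod φ)) (fromDiscrete (dom φ ↑ʳ_))

  spider : ∀ a b → Cospan a b
  spider a b = cospan {apex = discrete 1} (fromDiscrete (λ _ → zero)) (fromDiscrete (λ _ → zero))

  ⟪_⟫ : ∀ {m n} → STerm m n → Cospan m n
  ⟪ gen φ ⟫ = genᶜ φ
  ⟪ μ ⟫     = spider 2 1
  ⟪ η ⟫     = spider 0 1
  ⟪ δ ⟫     = spider 1 2
  ⟪ ε ⟫     = spider 1 0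
  ⟪ id n ⟫  = idᶜ n
  ⟪ f ⨾ g ⟫ = ⟪ f ⟫ ⨾ᶜ ⟪ g ⟫
  ⟪ f ⊗ g ⟫ = ⟪ f ⟫ ⊗ᶜ ⟪ g ⟫
  ⟪ σ m n ⟫ = σᶜ m n

  -- Counts positions, with multiplicity: in-degree from targets, then
  -- out-degree from sources.
  degree : (F : Hypergraph) → Fin (vertices F) → ℕ × ℕ
  degree F v = sum (tabulate λ e → count (v ≟_) (targets F e))
             , sum (tabulate λ e → count (v ≟_) (sources F e))

  record PartialLeftMonogamous {m n} (c : Cospan m n) : Set where
    field
      left-mono   : Mono (left c)
      inImage     : ∀ v → (∃[ i ] vmap (left c) i ≡ v) →
                    ∃[ o ] degree (apex c) v ≡ (0 , o)
      notInImage  : ∀ v → ¬ (∃[ i ] vmap (left c) i ≡ v) →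
                    ∃[ o ] (degree (apex c) v ≡ (0 , o) ⊎ degree (apex c) v ≡ (1 , o))

{-# OPTIONS --safe #-}

-- A cospan is partial left-monogamous exactly when its input legs and hyperedge
-- target positions, taken together, name each vertex at most once.  This
-- survives composition and trace because each merging identifies an output
-- with an input, and the inputs being merged name distinct vertices that
-- nothing else names, so each can be redirected to its output without touching
-- the remaining names.  Conversely, a hyperedge can be split off such a cospan
-- by making its targets inputs and its sources outputs, and is plugged back in
-- by tracing its targets; once no hyperedge is left, the cospan is a traced
-- comonoid term.
-- All computations of cospans are made on presentations: quotients of
-- hypergraphs by arbitrary families of pairs, on which composition merely
-- takes disjoint unions and adds pairs.
module Submission where

open import Data.Nat using (ℕ; zero; suc; _+_; _≤_; z≤n; s≤s)
open import Data.Nat.Properties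
  using (+-assoc; +-identityʳ; n≤0⇒n≡0; m+n≡0⇒m≡0; m+n≡0⇒n≡0; m≤m+n; m≤n+m; ≤-trans; ≤-refl; ≤-reflexive)
  renaming (0≢1+n to 0≢1+nᴺ; suc-injective to ℕ-suc-injective)
open import Data.Fin using (Fin; zero; suc; _↑ˡ_; _↑ʳ_; splitAt; join; toℕ)
import Data.Fin as Fin
open import Data.Fin.Properties
  using (_≟_; splitAt-↑ˡ; splitAt-↑ʳ; join-splitAt; splitAt-join; toℕ-injective; toℕ-cast; toℕ-↑ˡ; toℕ-↑ʳ;
         cast-is-id; suc-injective; 0≢1+n; ↑ˡ-injective; ↑ʳ-injective; any?)
open import Data.Vec using (Vec; []; _∷_; toList; tabulate; count; sum)
import Data.Vec as Vec
open import Data.List using (List; []; _∷_; map)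
open import Data.List.Properties using (map-id; map-∘; map-cong)
open import Data.Product using (∃; ∃-syntax; _×_; _,_; proj₁; proj₂)
open import Data.Sum using (_⊎_; inj₁; inj₂; [_,_]′; swap)
import Data.Sum as Sum
open import Data.Sum.Properties using (≡-dec; inj₁-injective; inj₂-injective)
open import Data.Empty using (⊥)
open import Function using (_∘_; case_of_)
open import Function.Bundles using (_⇔_; mk⇔)
open import Relation.Nullary using (¬_; Dec; yes; no; contradiction)
open import Relation.Binary.Bundles using (Setoid)
open import Relation.Binary.Definitions using (DecidableEquality)
open import Relation.Binary.PropositionalEquality
  using (_≡_; _≢_; _≗_; refl; sym; trans; cong; cong₂; subst; module ≡-Reasoning)
open import Defs

-- Functions out of finite sums.

infixr 6 _▿_ _⊞_

_▿_ : ∀ {a b} {A : Set} → (Fin a → A) → (Fin b → A) → Fin (a + b) → A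
_▿_ {a} f g = [ f , g ]′ ∘ splitAt a

▿-ˡ : ∀ {a b} {A : Set} (f : Fin a → A) (g : Fin b → A) i → (f ▿ g) (i ↑ˡ b) ≡ f i
▿-ˡ {a} {b} f g i = cong [ f , g ]′ (splitAt-↑ˡ a i b)

▿-ʳ : ∀ {a b} {A : Set} (f : Fin a → A) (g : Fin b → A) i → (f ▿ g) (a ↑ʳ i) ≡ g i
▿-ʳ {a} {b} f g i = cong [ f , g ]′ (splitAt-↑ʳ a b i)

+-elim : ∀ a {b} (P : Fin (a + b) → Set) →
         (∀ i → P (i ↑ˡ b)) → (∀ i → P (a ↑ʳ i)) → ∀ i → P i
+-elim a {b} P l r i = subst P (join-splitAt a b i) (go (splitAt a i))
  where
  go : ∀ s → P (join a b s)
  go (inj₁ j) = l j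
  go (inj₂ j) = r j

∘-▿ : ∀ {a b} {A B : Set} (h : A → B) (f : Fin a → A) (g : Fin b → A) →
      h ∘ (f ▿ g) ≗ (h ∘ f) ▿ (h ∘ g)
∘-▿ {a} h f g i with splitAt a i
... | inj₁ _ = refl
... | inj₂ _ = refl

▿-cong : ∀ {a b} {A : Set} {f f′ : Fin a → A} {g g′ : Fin b → A} →
         f ≗ f′ → g ≗ g′ → f ▿ g ≗ f′ ▿ g′
▿-cong {a} p q i with splitAt a i
... | inj₁ j = p j
... | inj₂ j = q j

_⊞_ : ∀ {a b c d} → (Fin a → Fin c) → (Fin b → Fin d) → Fin (a + b) → Fin (c + d)
_⊞_ {c = c} {d} f g = ((_↑ˡ d) ∘ f) ▿ ((c ↑ʳ_) ∘ g)

idᶠ : ∀ {n} → Fin n → Fin n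
idᶠ i = i

⊞-cong-id : ∀ {a b} {f : Fin a → Fin a} {g : Fin b → Fin b} → f ≗ idᶠ → g ≗ idᶠ → f ⊞ g ≗ idᶠ
⊞-cong-id {a} {b} p q = λ i →
  trans (▿-cong {a} (cong (_↑ˡ b) ∘ p) (cong (a ↑ʳ_) ∘ q) i) (join-splitAt a b i)

¡ : ∀ {A : Set} → Fin 0 → A
¡ ()

σᶠ : ∀ m n → Fin (n + m) → Fin (m + n)
σᶠ m n = join m n ∘ swap ∘ splitAt n

σᶠ-involutive : ∀ m n i → σᶠ m n (σᶠ n m i) ≡ i
σᶠ-involutive m n i = trans (cong (join m n ∘ swap) (splitAt-join n m (swap (splitAt m i))))
  (trans (cong (join m n) (swap-swap (splitAt m i))) (join-splitAt m n i))
  where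
  swap-swap : ∀ {A B : Set} (s : A ⊎ B) → swap (swap s) ≡ s
  swap-swap (inj₁ _) = refl
  swap-swap (inj₂ _) = refl

-- A cast does not change `toℕ`, so it suffices to compare natural numbers. These three lemmas
-- compute the reassociations hidden in `cast` separately on each summand.
cast-assoc-ˡ : ∀ {a} b c .(eq : a + (b + c) ≡ a + b + c) i →
               Fin.cast eq (i ↑ˡ (b + c)) ≡ (i ↑ˡ b) ↑ˡ c
cast-assoc-ˡ b c eq i = toℕ-injective (trans (toℕ-cast eq (i ↑ˡ (b + c)))
  (trans (toℕ-↑ˡ i (b + c)) (sym (trans (toℕ-↑ˡ (i ↑ˡ b) c) (toℕ-↑ˡ i b)))))

cast-assoc-ᵐ : ∀ a {b} c .(eq : a + (b + c) ≡ a + b + c) i →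
               Fin.cast eq (a ↑ʳ (i ↑ˡ c)) ≡ (a ↑ʳ i) ↑ˡ c
cast-assoc-ᵐ a c eq i = toℕ-injective (trans (toℕ-cast eq (a ↑ʳ (i ↑ˡ c)))
  (trans (toℕ-↑ʳ a (i ↑ˡ c)) (trans (cong (a +_) (toℕ-↑ˡ i c))
    (sym (trans (toℕ-↑ˡ (a ↑ʳ i) c) (toℕ-↑ʳ a i))))))

cast-assoc-ʳ : ∀ a b {c} .(eq : a + (b + c) ≡ a + b + c) (i : Fin c) →
               Fin.cast eq (a ↑ʳ (b ↑ʳ i)) ≡ (a + b) ↑ʳ i
cast-assoc-ʳ a b eq i = toℕ-injective (trans (toℕ-cast eq (a ↑ʳ (b ↑ʳ i)))
  (trans (toℕ-↑ʳ a (b ↑ʳ i)) (trans (cong (a +_) (toℕ-↑ʳ b i))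
    (sym (trans (toℕ-↑ʳ (a + b) i) (+-assoc a b (toℕ i)))))))

codiagonal : ∀ {n} → Fin (n + n) → Fin n
codiagonal = idᶠ ▿ idᶠ

-- The permutation of wires in the successor case of `δs` and `μs`: the heads of the two blocks go
-- to positions 0 and 1, the tails follow.
interleave : ∀ n → Fin (suc n + suc n) → Fin (2 + (n + n))
interleave n = (idᶠ {1} ⊞ (σᶠ 1 n ⊞ idᶠ {n})) ∘ Fin.cast (sym (cong suc (+-assoc n 1 n)))

fold₂ : ∀ n → Fin (2 + (n + n)) → Fin (suc n)
fold₂ n = (λ (_ : Fin 2) → zero {0}) ⊞ codiagonal {n}

-- The induction step for both `δs` and `μs`. Folding the two heads and the two tails separately
-- agrees with folding the blocks, as is checked on the head and the tail of each block.
interleave-codiagonal : ∀ n → fold₂ n ∘ interleave n ≗ codiagonal {suc n}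
interleave-codiagonal n = +-elim (suc n) (λ i → fold₂ n (interleave n i) ≡ codiagonal {suc n} i) left right
  where
  open ≡-Reasoning
  inner : Fin ((n + 1) + n) → Fin (suc n)
  inner = fold₂ n ∘ (idᶠ {1} ⊞ (σᶠ 1 n ⊞ idᶠ {n})) ∘ suc

  inner-ˡ : ∀ j → inner ((j ↑ˡ 1) ↑ˡ n) ≡ suc j
  inner-ˡ j = begin
    inner ((j ↑ˡ 1) ↑ˡ n)
      ≡⟨ cong (fold₂ n ∘ suc) (▿-ˡ ((_↑ˡ n) ∘ σᶠ 1 n) (suc n ↑ʳ_) (j ↑ˡ 1)) ⟩
    fold₂ n (suc (σᶠ 1 n (j ↑ˡ 1) ↑ˡ n))
      ≡⟨ cong (λ s → fold₂ n (suc (join 1 n (swap s) ↑ˡ n))) (splitAt-↑ˡ n j 1) ⟩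
    suc (codiagonal (j ↑ˡ n))
      ≡⟨ cong suc (▿-ˡ idᶠ idᶠ j) ⟩
    suc j ∎

  inner-ᵐ : inner ((n ↑ʳ zero) ↑ˡ n) ≡ zero
  inner-ᵐ = begin
    inner ((n ↑ʳ zero) ↑ˡ n)
      ≡⟨ cong (fold₂ n ∘ suc) (▿-ˡ ((_↑ˡ n) ∘ σᶠ 1 n) (suc n ↑ʳ_) (n ↑ʳ zero)) ⟩
    fold₂ n (suc (σᶠ 1 n (n ↑ʳ zero) ↑ˡ n))
      ≡⟨ cong (λ s → fold₂ n (suc (join 1 n (swap s) ↑ˡ n))) (splitAt-↑ʳ n 1 zero) ⟩
    zero ∎

  inner-ʳ : ∀ j → inner ((n + 1) ↑ʳ j) ≡ suc j
  inner-ʳ j = begin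
    inner ((n + 1) ↑ʳ j)
      ≡⟨ cong (fold₂ n ∘ suc) (▿-ʳ ((_↑ˡ n) ∘ σᶠ 1 n) (suc n ↑ʳ_) j) ⟩
    suc (codiagonal (n ↑ʳ j))
      ≡⟨ cong suc (▿-ʳ {n} idᶠ idᶠ j) ⟩
    suc j ∎

  left : ∀ i → fold₂ n (interleave n (i ↑ˡ suc n)) ≡ codiagonal {suc n} (i ↑ˡ suc n)
  left zero    = refl
  left (suc j) = trans (cong inner (cast-assoc-ˡ 1 n _ j))
                       (trans (inner-ˡ j) (sym (▿-ˡ {suc n} idᶠ idᶠ (suc j))))

  right : ∀ i → fold₂ n (interleave n (suc n ↑ʳ i)) ≡ codiagonal {suc n} (suc n ↑ʳ i)
  right zero    = trans (cong inner (cast-assoc-ᵐ n n _ zero))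
                        (trans inner-ᵐ (sym (▿-ʳ {suc n} idᶠ idᶠ zero)))
  right (suc j) = trans (cong inner (cast-assoc-ʳ n 1 _ j))
                        (trans (inner-ʳ j) (sym (▿-ʳ {suc n} idᶠ idᶠ (suc j))))

-- Distinctness of names, and redirection of vertices.

▿-injective : ∀ {a b} {A : Set} {f : Fin a → A} {g : Fin b → A} →
              (∀ {i j} → f i ≡ f j → i ≡ j) → (∀ {i j} → g i ≡ g j → i ≡ j) → (∀ i j → f i ≢ g j) →
              ∀ {i j} → (f ▿ g) i ≡ (f ▿ g) j → i ≡ j
▿-injective {a} {b} {f = f} {g} f-inj g-inj f≢g {i} {j} eq =
  trans (sym (join-splitAt a b i)) (trans (cong (join a b) (go (splitAt a i) (splitAt a j) eq)) (join-splitAt a b j))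
  where
  go : ∀ s t → [ f , g ]′ s ≡ [ f , g ]′ t → s ≡ t
  go (inj₁ _) (inj₁ _) eq = cong inj₁ (f-inj eq)
  go (inj₁ _) (inj₂ _) eq = contradiction eq (f≢g _ _)
  go (inj₂ _) (inj₁ _) eq = contradiction (sym eq) (f≢g _ _)
  go (inj₂ _) (inj₂ _) eq = cong inj₂ (g-inj eq)

▿-avoids : ∀ {a b} {A : Set} {f : Fin a → A} {g : Fin b → A} {x} →
           (∀ i → f i ≢ x) → (∀ i → g i ≢ x) → ∀ i → (f ▿ g) i ≢ x
▿-avoids {a} p q i with splitAt a i
... | inj₁ j = p j
... | inj₂ j = q j

↑ˡ≢↑ʳ : ∀ {m n} (i : Fin m) (j : Fin n) → i ↑ˡ n ≢ m ↑ʳ j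
↑ˡ≢↑ʳ {m} {n} i j eq =
  case trans (sym (splitAt-↑ˡ m i n)) (trans (cong (splitAt m) eq) (splitAt-↑ʳ m n j)) of λ ()

-- Replaces each `v i` by `u i`, one index at a time. The result respects the gluing of `u` with `v`
-- and moves nothing outside the image of `v`, which shows that the gluing identifies no two
-- distinct points outside that image.
redirect : ∀ {W : Set} → DecidableEquality W → ∀ k (u v : Fin k → W) → (∀ {i j} → v i ≡ v j → i ≡ j) →
           ∃ λ (h : W → W) → h ∘ u ≗ h ∘ v × (∀ w → (∀ j → v j ≢ w) → h w ≡ w)
redirect {W} _≟ʷ_ zero    u v v-inj = (λ w → w) , (λ ()) , λ _ _ → refl
redirect {W} _≟ʷ_ (suc k) u v v-inj = h ∘ step , glue , fix
  where
  step : W → W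
  step w with v zero ≟ʷ w
  ... | yes _ = u zero
  ... | no  _ = w

  step-v : step (v zero) ≡ u zero
  step-v with v zero ≟ʷ v zero
  ... | yes _ = refl
  ... | no ¬p = contradiction refl ¬p

  step-u : step (u zero) ≡ u zero
  step-u with v zero ≟ʷ u zero
  ... | yes _ = refl
  ... | no  _ = refl

  step-≢ : ∀ {w} → v zero ≢ w → step w ≡ w
  step-≢ {w} p with v zero ≟ʷ w
  ... | yes eq = contradiction eq p
  ... | no  _  = refl

  -- A later `u` may coincide with `v zero`, so it has to be redirected first; a later `v` cannot,
  -- by injectivity.
  rest = redirect _≟ʷ_ k (step ∘ u ∘ suc) (v ∘ suc) (λ eq → suc-injective (v-inj eq))
  h = proj₁ rest

  glue : h ∘ step ∘ u ≗ h ∘ step ∘ v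
  glue zero    = cong h (trans step-u (sym step-v))
  glue (suc j) = trans (proj₁ (proj₂ rest) j)
                       (cong h (sym (step-≢ (λ eq → 0≢1+n (v-inj eq)))))

  fix : ∀ w → (∀ j → v j ≢ w) → h (step w) ≡ w
  fix w p = trans (cong h (step-≢ (p zero))) (proj₂ (proj₂ rest) w (p ∘ suc))

-- Positions in lists, and counting.

-- Positions are plain natural numbers and carriers are lists, so that target positions of
-- hyperedges with different coarities can be compared.
data At {A : Set} : List A → ℕ → A → Set where
  here  : ∀ {x xs} → At (x ∷ xs) 0 x
  there : ∀ {x xs i y} → At xs i y → At (x ∷ xs) (suc i) y

At-map⁻ : ∀ {A B : Set} {f : A → B} xs {i y} → At (map f xs) i y → ∃ λ x → At xs i x × f x ≡ y
At-map⁻ (x ∷ xs) here      = x , here , refl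
At-map⁻ (x ∷ xs) (there p) with At-map⁻ xs p
... | y , q , eq = y , there q , eq

At-tabulate⁻ : ∀ {A : Set} {n} (f : Fin n → A) {i x} → At (toList (tabulate f)) i x →
               ∃ λ j → toℕ j ≡ i × f j ≡ x
At-tabulate⁻ {n = suc n} f here      = zero , refl , refl
At-tabulate⁻ {n = suc n} f (there p) with At-tabulate⁻ (f ∘ suc) p
... | j , refl , eq = suc j , refl , eq

At-lookup : ∀ {A : Set} {n} (xs : Vec A n) j → At (toList xs) (toℕ j) (Vec.lookup xs j)
At-lookup (x ∷ xs) zero    = here
At-lookup (x ∷ xs) (suc j) = there (At-lookup xs j)

module _ {n} (v : Fin n) where

  count≡0⇒¬At : ∀ {k} (xs : Vec (Fin n) k) → count (v ≟_) xs ≡ 0 → ∀ {i} → ¬ At (toList xs) i v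
  count≡0⇒¬At (x ∷ xs) eq p with v ≟ x
  count≡0⇒¬At (x ∷ xs) () p         | yes _
  count≡0⇒¬At (x ∷ xs) eq here      | no v≢v = v≢v refl
  count≡0⇒¬At (x ∷ xs) eq (there p) | no _   = count≡0⇒¬At xs eq p

  count≤1⇒At-unique : ∀ {k} (xs : Vec (Fin n) k) → count (v ≟_) xs ≤ 1 →
                      ∀ {i j} → At (toList xs) i v → At (toList xs) j v → i ≡ j
  count≤1⇒At-unique (x ∷ xs) le p q with v ≟ x
  count≤1⇒At-unique (x ∷ xs) le       here      here      | _     = refl
  count≤1⇒At-unique (x ∷ xs) (s≤s le) here      (there q) | yes _ = contradiction q (count≡0⇒¬At xs (n≤0⇒n≡0 le))
  count≤1⇒At-unique (x ∷ xs) (s≤s le) (there p) _         | yes _ = contradiction p (count≡0⇒¬At xs (n≤0⇒n≡0 le))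
  count≤1⇒At-unique (x ∷ xs) le       here      (there q) | no ¬p = contradiction refl ¬p
  count≤1⇒At-unique (x ∷ xs) le       (there p) here      | no ¬p = contradiction refl ¬p
  count≤1⇒At-unique (x ∷ xs) le       (there p) (there q) | no _  = cong suc (count≤1⇒At-unique xs le p q)

  count≢0⇒At : ∀ {k} (xs : Vec (Fin n) k) → count (v ≟_) xs ≢ 0 → ∃ λ i → At (toList xs) i v
  count≢0⇒At []       p = contradiction refl p
  count≢0⇒At (x ∷ xs) p with v ≟ x
  ... | yes refl = 0 , here
  ... | no  _    with count≢0⇒At xs p
  ...   | i , q = suc i , there q

  ¬At⇒count≡0 : ∀ {k} (xs : Vec (Fin n) k) → (∀ {i} → ¬ At (toList xs) i v) → count (v ≟_) xs ≡ 0
  ¬At⇒count≡0 xs p with count (v ≟_) xs in eq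
  ... | zero  = refl
  ... | suc _ = contradiction (proj₂ (count≢0⇒At xs (λ eq′ → 0≢1+nᴺ (trans (sym eq′) eq)))) p

  At-unique⇒count≤1 : ∀ {k} (xs : Vec (Fin n) k) →
                      (∀ {i j} → At (toList xs) i v → At (toList xs) j v → i ≡ j) → count (v ≟_) xs ≤ 1
  At-unique⇒count≤1 []       p = z≤n
  At-unique⇒count≤1 (x ∷ xs) p with v ≟ x
  ... | yes refl = s≤s (≤-reflexive (¬At⇒count≡0 xs (λ q → case p here (there q) of λ ())))
  ... | no  _    = At-unique⇒count≤1 xs (λ q q′ → ℕ-suc-injective (p (there q) (there q′)))

sum≡0⇒≡0 : ∀ {n} (f : Fin n → ℕ) → sum (tabulate f) ≡ 0 → ∀ i → f i ≡ 0
sum≡0⇒≡0 f eq zero    = m+n≡0⇒m≡0 (f zero) eq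
sum≡0⇒≡0 f eq (suc i) = sum≡0⇒≡0 (f ∘ suc) (m+n≡0⇒n≡0 (f zero) eq) i

≡0⇒sum≡0 : ∀ {n} (f : Fin n → ℕ) → (∀ i → f i ≡ 0) → sum (tabulate f) ≡ 0
≡0⇒sum≡0 {zero}  f p = refl
≡0⇒sum≡0 {suc n} f p = trans (cong (_+ sum (tabulate (f ∘ suc))) (p zero)) (≡0⇒sum≡0 (f ∘ suc) (p ∘ suc))

≤sum : ∀ {n} (f : Fin n → ℕ) i → f i ≤ sum (tabulate f)
≤sum f zero    = m≤m+n (f zero) _
≤sum f (suc i) = ≤-trans (≤sum (f ∘ suc) i) (m≤n+m _ (f zero))

sum≤1⇒unique : ∀ {n} (f : Fin n → ℕ) → sum (tabulate f) ≤ 1 → ∀ {i j} → f i ≢ 0 → f j ≢ 0 → i ≡ j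
sum≤1⇒unique f le {zero}  {zero}  p q = refl
sum≤1⇒unique f le {suc i} {suc j} p q = cong suc (sum≤1⇒unique (f ∘ suc) (≤-trans (m≤n+m _ (f zero)) le) p q)
sum≤1⇒unique f le {zero}  {suc j} p q with f zero
... | zero  = contradiction refl p
sum≤1⇒unique f (s≤s le) {zero}  {suc j} p q | suc k =
  contradiction (sum≡0⇒≡0 (f ∘ suc) (m+n≡0⇒n≡0 k (n≤0⇒n≡0 le)) j) q
sum≤1⇒unique f le {suc i} {zero}  p q = sym (sum≤1⇒unique f le q p)

unique⇒sum≤1 : ∀ {n} (f : Fin n → ℕ) → (∀ i → f i ≤ 1) → (∀ {i j} → f i ≢ 0 → f j ≢ 0 → i ≡ j) →
               sum (tabulate f) ≤ 1
unique⇒sum≤1 {zero}  f le p = z≤n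
unique⇒sum≤1 {suc n} f le p with f zero in eq
... | zero  = unique⇒sum≤1 (f ∘ suc) (le ∘ suc) (λ q q′ → suc-injective (p q q′))
-- A nonzero head forces every later entry to vanish, so the sum equals the head, which is bounded
-- by 1.
... | suc k = subst (_≤ 1)
  (trans (sym (+-identityʳ (suc k))) (cong (suc k +_) (sym (≡0⇒sum≡0 (f ∘ suc) rest≡0))))
  (subst (_≤ 1) eq (le zero))
  where
  rest≡0 : ∀ i → f (suc i) ≡ 0
  rest≡0 i with f (suc i) in eq′
  ... | zero  = refl
  ... | suc _ = contradiction (p (λ z → 0≢1+nᴺ (trans (sym z) eq)) (λ z → 0≢1+nᴺ (trans (sym z) eq′))) 0≢1+n

-- Presentations of cospans.

module Presentations (𝕊 : Signature) where
  open Signature 𝕊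
  open Over 𝕊

  -- A presentation of a cospan: K indexes the pairs u k, v k of vertices still
  -- to be identified.
  record Raw (m n : ℕ) : Set₁ where
    field
      W E K   : Set
      lab     : E → Gen
      src tgt : E → List W
      l       : Fin m → W
      r       : Fin n → W
      u v     : K → W

  open Raw public

  Glues : ∀ {m n} (R : Raw m n) {A : Set} → (W R → A) → Set
  Glues R h = h ∘ u R ≗ h ∘ v R

  -- The equivalence generated by u k ∼ v k, in its impredicative form, which
  -- is what a coequaliser provides.
  infix 4 _⊢_∼_
  _⊢_∼_ : ∀ {m n} (R : Raw m n) → W R → W R → Set₁
  R ⊢ x ∼ y = ∀ {A : Set} (h : W R → A) → Glues R h → h x ≡ h y

  infix 4 _⊩_
  -- `q` with its section `rep` makes the vertices of `c` the quotient of `W R`: `q-glue` says that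
  -- all listed pairs are identified, `rep-q` that nothing is identified beyond what they generate.
  -- Hyperedges are matched bijectively.
  record _⊩_ {m n} (c : Cospan m n) (R : Raw m n) : Set₁ where
    field
      q            : W R → Fin (vertices (apex c))
      q-glue       : Glues R q
      rep          : Fin (vertices (apex c)) → W R
      q-rep        : ∀ y → q (rep y) ≡ y
      rep-q        : ∀ x → R ⊢ rep (q x) ∼ x
      edge         : E R → Fin (edges (apex c))
      edge⁻¹       : Fin (edges (apex c)) → E R
      edge-edge⁻¹  : ∀ e → edge (edge⁻¹ e) ≡ e
      edge⁻¹-edge  : ∀ e → edge⁻¹ (edge e) ≡ e
      label-edge   : ∀ e → label (apex c) (edge e) ≡ lab R e
      sources-edge : ∀ e → toList (sources (apex c) (edge e)) ≡ map q (src R e)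
      targets-edge : ∀ e → toList (targets (apex c) (edge e)) ≡ map q (tgt R e)
      left-leg     : ∀ i → vmap (left c) i ≡ q (l R i)
      right-leg    : ∀ i → vmap (right c) i ≡ q (r R i)

  module _ {m n} {c d : Cospan m n} {R : Raw m n} (C : c ⊩ R) (D : d ⊩ R) where
    private
      module C = _⊩_ C
      module D = _⊩_ D

      vm : Fin (vertices (apex c)) → Fin (vertices (apex d))
      vm = D.q ∘ C.rep

      vm-q : ∀ x → vm (C.q x) ≡ D.q x
      vm-q x = C.rep-q x D.q D.q-glue

      ends : ∀ {xs ys} {ws : List (W R)} → ys ≡ map D.q ws → xs ≡ map C.q ws → ys ≡ map vm xs
      ends {ws = ws} p refl = trans p (sym (trans (sym (map-∘ ws)) (map-cong vm-q ws)))

    -- A vertex is sent along a chosen representative; the choice is immaterial since `D.q` respects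
    -- the gluing.
    comparison : apex c ⇒ apex d
    comparison = record
      { vmap         = vm
      ; emap         = D.edge ∘ C.edge⁻¹
      ; pres-label   = λ e → trans (D.label-edge _)
          (trans (sym (C.label-edge _)) (cong (label (apex c)) (C.edge-edge⁻¹ e)))
      ; pres-sources = λ e → ends (D.sources-edge _)
          (trans (cong (toList ∘ sources (apex c)) (sym (C.edge-edge⁻¹ e))) (C.sources-edge _))
      ; pres-targets = λ e → ends (D.targets-edge _)
          (trans (cong (toList ∘ targets (apex c)) (sym (C.edge-edge⁻¹ e))) (C.targets-edge _))
      }

    comparison-q : ∀ x → vmap comparison (C.q x) ≡ D.q x
    comparison-q = vm-q

  comparison-inverse : ∀ {m n} {c d : Cospan m n} {R} (C : c ⊩ R) (D : d ⊩ R) →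
                       comparison D C ∘ₕ comparison C D ≈ₕ idₕ
  comparison-inverse C D =
      (λ y → trans (comparison-q D C (C.rep y)) (C.q-rep y))
    , (λ e → trans (cong C.edge (D.edge⁻¹-edge _)) (C.edge-edge⁻¹ e))
    where
    module C = _⊩_ C
    module D = _⊩_ D

  -- The comparison maps are determined by their values on the classes `q x`, hence mutually
  -- inverse. This is how a realising term is finally matched with the given cospan.
  ⊩-unique : ∀ {m n} {c d : Cospan m n} {R} → c ⊩ R → d ⊩ R → c ≅ d
  ⊩-unique {R = R} C D = record
    { to       = comparison C D
    ; from     = comparison D C
    ; from∘to  = comparison-inverse C D
    ; to∘from  = comparison-inverse D C
    ; to∘left  = (λ i → trans (cong (vmap (comparison C D)) (C.left-leg i))
                          (trans (comparison-q C D _) (sym (D.left-leg i)))) , λ ()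
    ; to∘right = (λ i → trans (cong (vmap (comparison C D)) (C.right-leg i))
                          (trans (comparison-q C D _) (sym (D.right-leg i)))) , λ ()
    }
    where
    module C = _⊩_ C
    module D = _⊩_ D

  infix 4 _≃_
  -- Vertex maps are inverse only up to the generated equivalences, so presentations with carriers
  -- of different size can agree. Compatibility with labels, ends and legs is stated for `f` and
  -- follows for `g`.
  record _≃_ {m n} (R S : Raw m n) : Set₁ where
    field
      f       : W R → W S
      g       : W S → W R
      f-glue  : ∀ k → S ⊢ f (u R k) ∼ f (v R k)
      g-glue  : ∀ k → R ⊢ g (u S k) ∼ g (v S k)
      g∘f     : ∀ x → R ⊢ g (f x) ∼ x
      f∘g     : ∀ y → S ⊢ f (g y) ∼ y
      ef      : E R → E S
      eg      : E S → E R
      eg∘ef   : ∀ e → eg (ef e) ≡ e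
      ef∘eg   : ∀ e → ef (eg e) ≡ e
      f-lab   : ∀ e → lab S (ef e) ≡ lab R e
      f-src   : ∀ e → src S (ef e) ≡ map f (src R e)
      f-tgt   : ∀ e → tgt S (ef e) ≡ map f (tgt R e)
      f-left  : ∀ i → S ⊢ f (l R i) ∼ l S i
      f-right : ∀ i → S ⊢ f (r R i) ∼ r S i

  ⊩-resp-≃ : ∀ {m n} {c : Cospan m n} {R S} → R ≃ S → c ⊩ R → c ⊩ S
  ⊩-resp-≃ {c = c} {R} {S} T C = record
    { q            = q ∘ g
    ; q-glue       = λ k → g-glue k q q-glue
    ; rep          = f ∘ rep
    ; q-rep        = λ y → trans (g∘f _ q q-glue) (q-rep y)
    ; rep-q        = λ y h glue →
        trans (rep-q (g y) (h ∘ f) (λ k → f-glue k h glue)) (f∘g y h glue)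
    ; edge         = edge ∘ eg
    ; edge⁻¹       = ef ∘ edge⁻¹
    ; edge-edge⁻¹  = λ e → trans (cong edge (eg∘ef _)) (edge-edge⁻¹ e)
    ; edge⁻¹-edge  = λ e → trans (cong ef (edge⁻¹-edge _)) (ef∘eg e)
    ; label-edge   = λ e → trans (label-edge (eg e)) (trans (sym (f-lab (eg e))) (cong (lab S) (ef∘eg e)))
    ; sources-edge = λ e → ends (sources-edge (eg e))
                             (trans (cong (src S) (sym (ef∘eg e))) (f-src (eg e)))
    ; targets-edge = λ e → ends (targets-edge (eg e))
                             (trans (cong (tgt S) (sym (ef∘eg e))) (f-tgt (eg e)))
    ; left-leg     = λ i → trans (left-leg i) (leg (f-left i))
    ; right-leg    = λ i → trans (right-leg i) (leg (f-right i))
    }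
    where
    open _≃_ T
    open _⊩_ C

    ends : ∀ {xs ys} {ws : List (W R)} → xs ≡ map q ws → ys ≡ map f ws → xs ≡ map (q ∘ g) ys
    ends {ws = ws} p refl =
      trans p (trans (map-cong (λ w → sym (g∘f w q q-glue)) ws) (map-∘ ws))

    leg : ∀ {x y} → S ⊢ f x ∼ y → q x ≡ q (g y)
    leg p = trans (sym (g∘f _ q q-glue)) (p (q ∘ g) (λ k → g-glue k q q-glue))

  withLegs : ∀ {m n m′ n′} (R : Raw m n) → (Fin m′ → W R) → (Fin n′ → W R) → Raw m′ n′
  withLegs R l′ r′ = record
    { W = W R ; E = E R ; K = K R ; lab = lab R ; src = src R ; tgt = tgt R
    ; l = l′ ; r = r′ ; u = u R ; v = v R }

  ⊩-legs : ∀ {m n} {c : Cospan m n} {R : Raw m n} {l′ r′} →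
           l R ≗ l′ → r R ≗ r′ → c ⊩ R → c ⊩ withLegs R l′ r′
  ⊩-legs p p′ C = record
    { q = q ; q-glue = q-glue ; rep = rep ; q-rep = q-rep ; rep-q = rep-q
    ; edge = edge ; edge⁻¹ = edge⁻¹ ; edge-edge⁻¹ = edge-edge⁻¹ ; edge⁻¹-edge = edge⁻¹-edge
    ; label-edge = label-edge ; sources-edge = sources-edge ; targets-edge = targets-edge
    ; left-leg  = λ i → trans (left-leg i) (cong q (p i))
    ; right-leg = λ i → trans (right-leg i) (cong q (p′ i))
    }
    where open _⊩_ C

  rawOf : ∀ {m n} (F : Hypergraph) → (Fin m → Fin (vertices F)) → (Fin n → Fin (vertices F)) → Raw m n
  rawOf F f g = record
    { W = Fin (vertices F) ; E = Fin (edges F) ; K = ⊥ ; lab = label F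
    ; src = toList ∘ sources F ; tgt = toList ∘ targets F
    ; l = f ; r = g ; u = λ () ; v = λ () }

  raw : ∀ {m n} → Cospan m n → Raw m n
  raw c = rawOf (apex c) (vmap (left c)) (vmap (right c))

  ⊩-raw : ∀ {m n} (c : Cospan m n) → c ⊩ raw c
  ⊩-raw c = record
    { q = λ x → x ; q-glue = λ () ; rep = λ x → x ; q-rep = λ _ → refl ; rep-q = λ _ _ _ → refl
    ; edge = λ e → e ; edge⁻¹ = λ e → e ; edge-edge⁻¹ = λ _ → refl ; edge⁻¹-edge = λ _ → refl
    ; label-edge = λ _ → refl ; sources-edge = λ _ → sym (map-id _) ; targets-edge = λ _ → sym (map-id _)
    ; left-leg = λ _ → refl ; right-leg = λ _ → refl }

  -- Tensor, composition and trace of presentations.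

  infixr 7 _⨾ᴿ_
  infixr 8 _⊗ᴿ_

  _⊗ᴿ_ : ∀ {m n p q} → Raw m n → Raw p q → Raw (m + p) (n + q)
  R ⊗ᴿ S = record
    { W   = W R ⊎ W S
    ; E   = E R ⊎ E S
    ; K   = K R ⊎ K S
    ; lab = [ lab R , lab S ]′
    ; src = [ map inj₁ ∘ src R , map inj₂ ∘ src S ]′
    ; tgt = [ map inj₁ ∘ tgt R , map inj₂ ∘ tgt S ]′
    ; l   = (inj₁ ∘ l R) ▿ (inj₂ ∘ l S)
    ; r   = (inj₁ ∘ r R) ▿ (inj₂ ∘ r S)
    ; u   = Sum.map (u R) (u S)
    ; v   = Sum.map (v R) (v S)
    }

  _⨾ᴿ_ : ∀ {m n p} → Raw m n → Raw n p → Raw m p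
  _⨾ᴿ_ {n = n} R S = record
    { W   = W R ⊎ W S
    ; E   = E R ⊎ E S
    ; K   = (K R ⊎ K S) ⊎ Fin n
    ; lab = [ lab R , lab S ]′
    ; src = [ map inj₁ ∘ src R , map inj₂ ∘ src S ]′
    ; tgt = [ map inj₁ ∘ tgt R , map inj₂ ∘ tgt S ]′
    ; l   = inj₁ ∘ l R
    ; r   = inj₂ ∘ r S
    ; u   = [ Sum.map (u R) (u S) , inj₁ ∘ r R ]′
    ; v   = [ Sum.map (v R) (v S) , inj₂ ∘ l S ]′
    }

  -- The description of the canonical trace by merging, with the `x` mergings recorded as pairs.
  traceᴿ : ∀ x {m n} → Raw (x + m) (x + n) → Raw m n
  traceᴿ x {m} {n} R = record
    { W   = W R ; E = E R
    ; K   = K R ⊎ Fin x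
    ; lab = lab R ; src = src R ; tgt = tgt R
    ; l   = l R ∘ (x ↑ʳ_)
    ; r   = r R ∘ (x ↑ʳ_)
    ; u   = [ u R , (λ a → r R (a ↑ˡ n)) ]′
    ; v   = [ v R , (λ a → l R (a ↑ˡ m)) ]′
    }

  -- The presentation of the coproduct of two apexes, shared by `⊗-⊩`, which uses it directly, and
  -- `⨾-⊩`, which follows it by a coequaliser.
  module Sums {m n p q} {c : Cospan m n} {d : Cospan p q} {R : Raw m n} {S : Raw p q}
              (C : c ⊩ R) (D : d ⊩ S) where
    module C = _⊩_ C
    module D = _⊩_ D
    F = apex c
    G = apex d

    esum : E R ⊎ E S → Fin (edges F + edges G)
    esum = [ (_↑ˡ edges G) ∘ C.edge , (edges F ↑ʳ_) ∘ D.edge ]′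

    esum⁻¹ : Fin (edges F + edges G) → E R ⊎ E S
    esum⁻¹ = Sum.map C.edge⁻¹ D.edge⁻¹ ∘ splitAt (edges F)

    esum-esum⁻¹ : ∀ e → esum (esum⁻¹ e) ≡ e
    esum-esum⁻¹ e = trans (go (splitAt (edges F) e)) (join-splitAt (edges F) (edges G) e)
      where
      go : ∀ s → esum (Sum.map C.edge⁻¹ D.edge⁻¹ s) ≡ join (edges F) (edges G) s
      go (inj₁ e) = cong (_↑ˡ edges G) (C.edge-edge⁻¹ e)
      go (inj₂ e) = cong (edges F ↑ʳ_) (D.edge-edge⁻¹ e)

    esum⁻¹-esum : ∀ e → esum⁻¹ (esum e) ≡ e
    esum⁻¹-esum (inj₁ e) = trans (cong (Sum.map C.edge⁻¹ D.edge⁻¹) (splitAt-↑ˡ _ (C.edge e) _))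
                                 (cong inj₁ (C.edge⁻¹-edge e))
    esum⁻¹-esum (inj₂ e) = trans (cong (Sum.map C.edge⁻¹ D.edge⁻¹) (splitAt-↑ʳ (edges F) _ (D.edge e)))
                                 (cong inj₂ (D.edge⁻¹-edge e))

    vsum : W R ⊎ W S → Fin (vertices F + vertices G)
    vsum = [ (_↑ˡ vertices G) ∘ C.q , (vertices F ↑ʳ_) ∘ D.q ]′

    vrep : Fin (vertices F + vertices G) → W R ⊎ W S
    vrep = (inj₁ ∘ C.rep) ▿ (inj₂ ∘ D.rep)

    vsum-vrep : ∀ y → vsum (vrep y) ≡ y
    vsum-vrep = +-elim (vertices F) _
      (λ i → trans (cong vsum (▿-ˡ _ _ i)) (cong (_↑ˡ _) (C.q-rep i)))
      (λ i → trans (cong vsum (▿-ʳ (inj₁ ∘ C.rep) _ i)) (cong (vertices F ↑ʳ_) (D.q-rep i)))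

    vrep-vsum : ∀ {A : Set} (h : W R ⊎ W S → A) → Glues R (h ∘ inj₁) → Glues S (h ∘ inj₂) →
                ∀ x → h (vrep (vsum x)) ≡ h x
    vrep-vsum h hR hS (inj₁ x) = trans (cong h (▿-ˡ _ _ (C.q x))) (C.rep-q x (h ∘ inj₁) hR)
    vrep-vsum h hR hS (inj₂ x) = trans (cong h (▿-ʳ (inj₁ ∘ C.rep) _ (D.q x))) (D.rep-q x (h ∘ inj₂) hS)

    ends : ∀ {A B X Z : Set} {xs ys} {ws : List A} {p : B → Z} {q : A → B} {i : A → X} {q′ : X → Z} →
           ys ≡ map p xs → xs ≡ map q ws → p ∘ q ≗ q′ ∘ i → ys ≡ map q′ (map i ws)
    ends {ws = ws} refl refl eq = trans (sym (map-∘ ws)) (trans (map-cong eq ws) (map-∘ ws))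

  ⊗-⊩ : ∀ {m n p q} {c : Cospan m n} {d : Cospan p q} {R S} → c ⊩ R → d ⊩ S → c ⊗ᶜ d ⊩ R ⊗ᴿ S
  ⊗-⊩ {m} {n} C D = record
    { q            = vsum
    ; q-glue       = λ { (inj₁ k) → cong (_↑ˡ vertices G) (C.q-glue k)
                       ; (inj₂ k) → cong (vertices F ↑ʳ_) (D.q-glue k) }
    ; rep          = vrep
    ; q-rep        = vsum-vrep
    ; rep-q        = λ x h glue → vrep-vsum h (glue ∘ inj₁) (glue ∘ inj₂) x
    ; edge         = esum
    ; edge⁻¹       = esum⁻¹
    ; edge-edge⁻¹  = esum-esum⁻¹
    ; edge⁻¹-edge  = esum⁻¹-esum
    ; label-edge   = λ { (inj₁ e) → trans (pres-label (inl F G) _) (C.label-edge e)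
                       ; (inj₂ e) → trans (pres-label (inr F G) _) (D.label-edge e) }
    ; sources-edge = λ { (inj₁ e) → ends (pres-sources (inl F G) _) (C.sources-edge e) (λ _ → refl)
                       ; (inj₂ e) → ends (pres-sources (inr F G) _) (D.sources-edge e) (λ _ → refl) }
    ; targets-edge = λ { (inj₁ e) → ends (pres-targets (inl F G) _) (C.targets-edge e) (λ _ → refl)
                       ; (inj₂ e) → ends (pres-targets (inr F G) _) (D.targets-edge e) (λ _ → refl) }
    ; left-leg     = λ i → trans (▿-cong {m} (cong (_↑ˡ _) ∘ C.left-leg) (cong (vertices F ↑ʳ_) ∘ D.left-leg) i)
                                 (sym (∘-▿ {m} vsum _ _ i))
    ; right-leg    = λ i → trans (▿-cong {n} (cong (_↑ˡ _) ∘ C.right-leg) (cong (vertices F ↑ʳ_) ∘ D.right-leg) i)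
                                 (sym (∘-▿ {n} vsum _ _ i))
    }
    where open Sums C D

  ⨾-⊩ : ∀ {m n p} {c : Cospan m n} {d : Cospan n p} {R S} → c ⊩ R → d ⊩ S → c ⨾ᶜ d ⊩ R ⨾ᴿ S
  ⨾-⊩ {c = c} {d} {R} {S} C D = record
    { q            = Q.proj ∘ vsum
    ; q-glue       = λ { (inj₁ (inj₁ k)) → cong (λ x → Q.proj (x ↑ˡ vertices G)) (C.q-glue k)
                       ; (inj₁ (inj₂ k)) → cong (λ x → Q.proj (vertices F ↑ʳ x)) (D.q-glue k)
                       ; (inj₂ j) → trans (cong (λ x → Q.proj (x ↑ˡ vertices G)) (sym (C.right-leg j)))
                                      (trans (Q.coequal j)
                                         (cong (λ x → Q.proj (vertices F ↑ʳ x)) (D.left-leg j))) }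
    ; rep          = vrep ∘ Q.rep
    ; q-rep        = λ y → trans (cong Q.proj (vsum-vrep (Q.rep y))) (Q.proj-rep y)
    ; rep-q        = λ x h glue →
        let glueR = glue ∘ inj₁ ∘ inj₁
            glueS = glue ∘ inj₁ ∘ inj₂
        -- `h` descends in two stages, first along the coequaliser and then along the two
        -- presentations. For the first stage, `vrep-vsum` trades the chosen representatives for
        -- `r R j` and `l S j`, which the new pair `j` identifies.
        in trans (Q.descend (h ∘ vrep)
                   (λ j → trans (cong (λ y → h (vrep (y ↑ˡ vertices G))) (C.right-leg j))
                     (trans (vrep-vsum h glueR glueS (inj₁ (r R j)))
                     (trans (glue (inj₂ j))
                     (trans (sym (vrep-vsum h glueR glueS (inj₂ (l S j))))
                            (cong (λ y → h (vrep (vertices F ↑ʳ y))) (sym (D.left-leg j)))))))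
                   (vsum x))
                 (vrep-vsum h glueR glueS x)
    ; edge         = esum
    ; edge⁻¹       = esum⁻¹
    ; edge-edge⁻¹  = esum-esum⁻¹
    ; edge⁻¹-edge  = esum⁻¹-esum
    ; label-edge   = λ { (inj₁ e) → trans (pres-label P.i₁ _) (C.label-edge e)
                       ; (inj₂ e) → trans (pres-label P.i₂ _) (D.label-edge e) }
    ; sources-edge = λ { (inj₁ e) → ends (pres-sources P.i₁ _) (C.sources-edge e) (λ _ → refl)
                       ; (inj₂ e) → ends (pres-sources P.i₂ _) (D.sources-edge e) (λ _ → refl) }
    ; targets-edge = λ { (inj₁ e) → ends (pres-targets P.i₁ _) (C.targets-edge e) (λ _ → refl)
                       ; (inj₂ e) → ends (pres-targets P.i₂ _) (D.targets-edge e) (λ _ → refl) }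
    ; left-leg     = λ i → cong (vmap P.i₁) (C.left-leg i)
    ; right-leg    = λ i → cong (vmap P.i₂) (D.right-leg i)
    }
    where
    open Sums C D
    module P = Pushout (pushout (right c) (left d))
    module Q = Coequaliser (coequaliser ((_↑ˡ vertices G) ∘ vmap (right c))
                                        ((vertices F ↑ʳ_) ∘ vmap (left d)))

  -- Presentations without hyperedges.

  wires : ∀ {a m n} → (Fin m → Fin a) → (Fin n → Fin a) → Raw m n
  wires {a} = rawOf (discrete a)

  ⊗-wires : ∀ {a b m n p q} (f : Fin m → Fin a) (g : Fin n → Fin a) (h : Fin p → Fin b) (k : Fin q → Fin b) →
            wires f g ⊗ᴿ wires h k ≃ wires (f ⊞ h) (g ⊞ k)
  ⊗-wires {a} {b} {m} {n} f g h k = record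
    { f       = join a b
    ; g       = splitAt a
    ; f-glue  = λ { (inj₁ ()) ; (inj₂ ()) }
    ; g-glue  = λ ()
    ; g∘f     = λ x φ _ → cong φ (splitAt-join a b x)
    ; f∘g     = λ y φ _ → cong φ (join-splitAt a b y)
    ; ef      = λ { (inj₁ ()) ; (inj₂ ()) }
    ; eg      = λ ()
    ; eg∘ef   = λ { (inj₁ ()) ; (inj₂ ()) }
    ; ef∘eg   = λ ()
    ; f-lab   = λ { (inj₁ ()) ; (inj₂ ()) }
    ; f-src   = λ { (inj₁ ()) ; (inj₂ ()) }
    ; f-tgt   = λ { (inj₁ ()) ; (inj₂ ()) }
    ; f-left  = λ i φ _ → cong φ (∘-▿ {m} (join a b) _ _ i)
    ; f-right = λ i φ _ → cong φ (∘-▿ {n} (join a b) _ _ i)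
    }

  -- Each vertex of the second factor is paired with exactly one output of `R`, so it can be
  -- eliminated in favour of that output. With its mirror image `wires-⨾`, this composes wirings
  -- without any coequaliser whenever one of the meeting legs is the identity.
  ⨾-wires : ∀ {m n p} (R : Raw m n) (f : Fin p → Fin n) →
            R ⨾ᴿ wires idᶠ f ≃ withLegs R (l R) (r R ∘ f)
  ⨾-wires R f = record
    { f       = [ (λ x → x) , r R ]′
    ; g       = inj₁
    ; f-glue  = λ { (inj₁ (inj₁ k)) φ glue → glue k ; (inj₂ j) φ _ → refl }
    ; g-glue  = λ k φ glue → glue (inj₁ (inj₁ k))
    ; g∘f     = λ { (inj₁ x) φ _ → refl ; (inj₂ j) φ glue → glue (inj₂ j) }
    ; f∘g     = λ y φ _ → refl
    ; ef      = λ { (inj₁ e) → e }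
    ; eg      = inj₁
    ; eg∘ef   = λ { (inj₁ e) → refl }
    ; ef∘eg   = λ _ → refl
    ; f-lab   = λ { (inj₁ e) → refl }
    ; f-src   = λ { (inj₁ e) → trans (sym (map-id _)) (map-∘ (src R e)) }
    ; f-tgt   = λ { (inj₁ e) → trans (sym (map-id _)) (map-∘ (tgt R e)) }
    ; f-left  = λ i φ _ → refl
    ; f-right = λ i φ _ → refl
    }

  wires-⨾ : ∀ {m n p} (f : Fin m → Fin n) (R : Raw n p) →
            wires f idᶠ ⨾ᴿ R ≃ withLegs R (l R ∘ f) (r R)
  wires-⨾ f R = record
    { f       = [ l R , (λ x → x) ]′
    ; g       = inj₂
    ; f-glue  = λ { (inj₁ (inj₂ k)) φ glue → glue k ; (inj₂ j) φ _ → refl }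
    ; g-glue  = λ k φ glue → glue (inj₁ (inj₂ k))
    ; g∘f     = λ { (inj₁ j) φ glue → sym (glue (inj₂ j)) ; (inj₂ x) φ _ → refl }
    ; f∘g     = λ y φ _ → refl
    ; ef      = λ { (inj₂ e) → e }
    ; eg      = inj₂
    ; eg∘ef   = λ { (inj₂ e) → refl }
    ; ef∘eg   = λ _ → refl
    ; f-lab   = λ { (inj₂ e) → refl }
    ; f-src   = λ { (inj₂ e) → trans (sym (map-id _)) (map-∘ (src R e)) }
    ; f-tgt   = λ { (inj₂ e) → trans (sym (map-id _)) (map-∘ (tgt R e)) }
    ; f-left  = λ i φ _ → refl
    ; f-right = λ i φ _ → refl
    }

  -- Presentations of structural terms.

  -- Presentations of terms rather than of their interpretations, since the
  -- arguments of ⟪_⟫ are not recovered by unification.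
  infix 4 _⊨_
  record _⊨_ {m n} (t : STerm m n) (R : Raw m n) : Set₁ where
    constructor models
    field
      presents : ⟪ t ⟫ ⊩ R

  open _⊨_ public

  ⊨-resp-≃ : ∀ {m n} {t : STerm m n} {R S} → R ≃ S → t ⊨ R → t ⊨ S
  ⊨-resp-≃ T (models C) = models (⊩-resp-≃ T C)

  ⊨-wires : ∀ {a m n} {t : STerm m n} {f f′ : Fin m → Fin a} {g g′ : Fin n → Fin a} →
            f ≗ f′ → g ≗ g′ → t ⊨ wires f g → t ⊨ wires f′ g′
  ⊨-wires p p′ (models C) = models (⊩-legs p p′ C)

  ⊨-raw : ∀ {m n} (t : STerm m n) → t ⊨ raw ⟪ t ⟫
  ⊨-raw t = models (⊩-raw ⟪ t ⟫)

  ⨾-⊨ : ∀ {m n p} {s : STerm m n} {t : STerm n p} {R S} → s ⊨ R → t ⊨ S → s ⨾ t ⊨ R ⨾ᴿ S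
  ⨾-⊨ (models C) (models D) = models (⨾-⊩ C D)

  ⊗-⊨ : ∀ {m n p q} {s : STerm m n} {t : STerm p q} {R S} → s ⊨ R → t ⊨ S → s ⊗ t ⊨ R ⊗ᴿ S
  ⊗-⊨ (models C) (models D) = models (⊗-⊩ C D)

  ⊗-⊨-wires : ∀ {a b m n p q} {s : STerm m n} {t : STerm p q}
              {f : Fin m → Fin a} {g : Fin n → Fin a} {h : Fin p → Fin b} {k : Fin q → Fin b} →
              s ⊨ wires f g → t ⊨ wires h k → s ⊗ t ⊨ wires (f ⊞ h) (g ⊞ k)
  ⊗-⊨-wires {f = f} {g} {h} {k} C D = ⊨-resp-≃ (⊗-wires f g h k) (⊗-⊨ C D)

  ⨾-⊨-wires : ∀ {a m n p} {s : STerm m n} {t : STerm n p} {f : Fin m → Fin a} {g : Fin n → Fin a} {h : Fin p → Fin n} →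
              s ⊨ wires f g → t ⊨ wires idᶠ h → s ⨾ t ⊨ wires f (g ∘ h)
  ⨾-⊨-wires {f = f} {g} {h} C D = ⊨-resp-≃ (⨾-wires (wires f g) h) (⨾-⊨ C D)

  wires-⊨-⨾ : ∀ {a m n p} {s : STerm m n} {t : STerm n p} {f : Fin m → Fin n} {g : Fin n → Fin a} {h : Fin p → Fin a} →
              s ⊨ wires f idᶠ → t ⊨ wires g h → s ⨾ t ⊨ wires (g ∘ f) h
  wires-⊨-⨾ {f = f} {g} {h} C D = ⊨-resp-≃ (wires-⨾ f (wires g h)) (⨾-⊨ C D)

  id-⊨ : ∀ n → STerm.id n ⊨ wires idᶠ idᶠ
  id-⊨ n = ⊨-raw (id n)

  id₀-⊨ : ∀ {l r} → STerm.id 0 ⊨ wires l r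
  id₀-⊨ = ⊨-wires (λ ()) (λ ()) (id-⊨ 0)

  σ-⊨ : ∀ m n → STerm.σ m n ⊨ wires idᶠ (σᶠ m n)
  σ-⊨ m n = ⊨-raw (σ m n)

  -- The symmetry with its vertices renamed so that the right leg becomes the identity, as `wires-⨾`
  -- requires.
  σ-⊨′ : ∀ m n → STerm.σ m n ⊨ wires (σᶠ n m) idᶠ
  σ-⊨′ m n = ⊨-resp-≃ record
    { f       = σᶠ n m
    ; g       = σᶠ m n
    ; f-glue  = λ ()
    ; g-glue  = λ ()
    ; g∘f     = λ x φ _ → cong φ (σᶠ-involutive m n x)
    ; f∘g     = λ y φ _ → cong φ (σᶠ-involutive n m y)
    ; ef      = λ ()
    ; eg      = λ ()
    ; eg∘ef   = λ ()
    ; ef∘eg   = λ ()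
    ; f-lab   = λ ()
    ; f-src   = λ ()
    ; f-tgt   = λ ()
    ; f-left  = λ i φ _ → refl
    ; f-right = λ i φ _ → cong φ (σᶠ-involutive n m i)
    } (σ-⊨ m n)

  open PROPOps SOps using (cast)

  cast-⊨ : ∀ {a m n m′ n′} (p : m ≡ m′) (q : n ≡ n′) {t : STerm m n} {f : Fin m → Fin a} {g} → t ⊨ wires f g →
           cast p q t ⊨ wires (f ∘ Fin.cast (sym p)) (g ∘ Fin.cast (sym q))
  cast-⊨ refl refl {f = f} {g} =
    ⊨-wires (λ i → cong f (sym (cast-is-id refl i))) (λ i → cong g (sym (cast-is-id refl i)))

  castˡ-⊨ : ∀ {a m n m′} (p : m ≡ m′) {t : STerm m n} {f : Fin m → Fin a} {g} → t ⊨ wires f g →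
            cast p refl t ⊨ wires (f ∘ Fin.cast (sym p)) g
  castˡ-⊨ p {g = g} = ⊨-wires (λ _ → refl) (λ i → cong g (cast-is-id refl i)) ∘ cast-⊨ p refl

  castʳ-⊨ : ∀ {a m n n′} (q : n ≡ n′) {t : STerm m n} {f : Fin m → Fin a} {g} → t ⊨ wires f g →
            cast refl q t ⊨ wires f (g ∘ Fin.cast (sym q))
  castʳ-⊨ q {f = f} = ⊨-wires (λ i → cong f (cast-is-id refl i)) (λ _ → refl) ∘ cast-⊨ refl q

  -- The canonical trace computed on presentations.

  open CanonicalTrace SOps μ η δ ε

  ηs-⊨ : ∀ n → ηs n ⊨ wires ¡ idᶠ
  ηs-⊨ zero    = id₀-⊨
  ηs-⊨ (suc n) = ⊨-wires (λ ()) (λ { zero → refl ; (suc i) → refl })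
    (⊗-⊨-wires (⊨-raw η) (ηs-⊨ n))

  εs-⊨ : ∀ n → εs n ⊨ wires idᶠ ¡
  εs-⊨ zero    = id₀-⊨
  εs-⊨ (suc n) = ⊨-wires (λ { zero → refl ; (suc i) → refl }) (λ ())
    (⊗-⊨-wires (⊨-raw ε) (εs-⊨ n))

  interleave-σ : ∀ n → id 1 ⊗ (σ 1 n ⊗ id n) ⊨ wires idᶠ (idᶠ {1} ⊞ (σᶠ 1 n ⊞ idᶠ {n}))
  interleave-σ n = ⊨-wires (⊞-cong-id {1} (λ _ → refl) (⊞-cong-id {1 + n} (λ _ → refl) (λ _ → refl))) (λ _ → refl)
    (⊗-⊨-wires (id-⊨ 1) (⊗-⊨-wires (σ-⊨ 1 n) (id-⊨ n)))

  -- Read with identity outputs, `σ n 1` yields the function `σᶠ 1 n` that `σ 1 n` yields with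
  -- identity inputs; hence one computation of `interleave` serves `δs` and `μs` alike.
  interleave-σ′ : ∀ n → id 1 ⊗ (σ n 1 ⊗ id n) ⊨ wires (idᶠ {1} ⊞ (σᶠ 1 n ⊞ idᶠ {n})) idᶠ
  interleave-σ′ n = ⊨-wires (λ _ → refl) (⊞-cong-id {1} (λ _ → refl) (⊞-cong-id {1 + n} (λ _ → refl) (λ _ → refl)))
    (⊗-⊨-wires (id-⊨ 1) (⊗-⊨-wires (σ-⊨′ n 1) (id-⊨ n)))

  δs-⊨ : ∀ n → δs n ⊨ wires idᶠ codiagonal
  δs-⊨ zero    = id₀-⊨
  δs-⊨ (suc n) = ⊨-wires (λ { zero → refl ; (suc i) → refl }) (interleave-codiagonal n)
    (⨾-⊨-wires (⊗-⊨-wires (⊨-raw δ) (δs-⊨ n))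
      (castʳ-⊨ (cong suc (+-assoc n 1 n)) (interleave-σ n)))

  μs-⊨ : ∀ n → μs n ⊨ wires codiagonal idᶠ
  μs-⊨ zero    = id₀-⊨
  μs-⊨ (suc n) = ⊨-wires (interleave-codiagonal n) (λ { zero → refl ; (suc i) → refl })
    (wires-⊨-⨾ (castˡ-⊨ (cong suc (+-assoc n 1 n)) (interleave-σ′ n))
      (⊗-⊨-wires (⊨-raw μ) (μs-⊨ n)))

  cup-⊨ : ∀ n → cup n ⊨ wires ¡ codiagonal
  cup-⊨ n = ⨾-⊨-wires (ηs-⊨ n) (δs-⊨ n)

  cap-⊨ : ∀ n → cap n ⊨ wires codiagonal ¡
  cap-⊨ n = ⊨-wires (λ _ → refl) (λ ()) (⨾-⊨-wires (μs-⊨ n) (εs-⊨ n))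

  -- Puts the leg of the reassociated cup or cap into a form that separates the bent copy of the
  -- traced wires from the wires meeting `id x ⊗ f`.
  codiagonal-⊞ : ∀ x m → (codiagonal {x} ⊞ idᶠ {m}) ∘ Fin.cast (sym (+-assoc x x m)) ≗ (_↑ˡ m) ▿ idᶠ
  codiagonal-⊞ x m = +-elim x _
    (λ a → trans (cong bend (cast-assoc-ˡ x m _ a))
      (trans (▿-ˡ {x + x} _ _ (a ↑ˡ x))
      (trans (cong (_↑ˡ m) (▿-ˡ {x} idᶠ idᶠ a)) (sym (▿-ˡ {x} (_↑ˡ m) idᶠ a)))))
    (λ j → trans (tail j) (sym (▿-ʳ {x} (_↑ˡ m) idᶠ j)))
    where
    bend = codiagonal {x} ⊞ idᶠ {m}
    tail : ∀ j → bend (Fin.cast (sym (+-assoc x x m)) (x ↑ʳ j)) ≡ j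
    tail = +-elim x _
      (λ a → trans (cong bend (cast-assoc-ᵐ x m _ a))
        (trans (▿-ˡ {x + x} _ _ (x ↑ʳ a)) (cong (_↑ˡ m) (▿-ʳ {x} idᶠ idᶠ a))))
      (λ i → trans (cong bend (cast-assoc-ʳ x x _ i)) (▿-ʳ {x + x} ((_↑ˡ m) ∘ codiagonal) _ i))

  -- All vertices of the cup, of the straight wires `id x` and of the cap are glued to legs of `R`.
  -- Eliminating them leaves only the identification of output `a` with input `a` for each traced
  -- `a`.
  trace-≃ : ∀ x {m n} (R : Raw (x + m) (x + n)) →
            wires (x ↑ʳ_) ((_↑ˡ m) ▿ idᶠ) ⨾ᴿ (wires {x} idᶠ idᶠ ⊗ᴿ R) ⨾ᴿ wires ((_↑ˡ n) ▿ idᶠ) (x ↑ʳ_)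
            ≃ traceᴿ x R
  trace-≃ x {m} {n} R = record
    { f       = f
    ; g       = w
    ; f-glue  = λ
        { (inj₁ (inj₂ (inj₁ (inj₁ (inj₂ k))))) φ glue → glue (inj₁ k)
        ; (inj₁ (inj₂ (inj₂ j))) φ glue → +-elim x
            (λ j → φ (f (inj₂ (inj₁ (rB j)))) ≡ φ (f (inj₂ (inj₂ (lC j)))))
            (λ a → trans (cong (φ ∘ f ∘ inj₂ ∘ inj₁) (▿-ˡ (inj₁ ∘ idᶠ) (inj₂ ∘ r R) a))
              (trans (sym (glue (inj₂ a))) (cong (φ ∘ f ∘ inj₂ ∘ inj₂) (sym (▿-ˡ {x} (_↑ˡ n) idᶠ a)))))
            (λ i → trans (cong (φ ∘ f ∘ inj₂ ∘ inj₁) (▿-ʳ {x} (inj₁ ∘ idᶠ) (inj₂ ∘ r R) i))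
              (cong (φ ∘ f ∘ inj₂ ∘ inj₂) (sym (▿-ʳ {x} (_↑ˡ n) idᶠ i)))) j
        ; (inj₂ j) φ glue → cong φ (+-elim x
            (λ j → f (inj₁ (rA j)) ≡ f (inj₂ (inj₁ (lB j))))
            (λ a → trans (cong (f ∘ inj₁) (▿-ˡ {x} (_↑ˡ m) idᶠ a))
              (cong (f ∘ inj₂ ∘ inj₁) (sym (▿-ˡ {x} (inj₁ ∘ idᶠ) (inj₂ ∘ l R) a))))
            (λ i → trans (cong (f ∘ inj₁) (▿-ʳ {x} (_↑ˡ m) idᶠ i))
              (cong (f ∘ inj₂ ∘ inj₁) (sym (▿-ʳ {x} (inj₁ ∘ idᶠ) (inj₂ ∘ l R) i)))) j) }
    ; g-glue  = λ { (inj₁ k) φ glue → glue (inj₁ (inj₂ (inj₁ (inj₁ (inj₂ k)))))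
                  -- Output `a` is joined to input `a` through the cap, back along the straight
                  -- wire, and through the cup.
                  ; (inj₂ a) φ glue → trans (out φ glue (a ↑ˡ n)) (trans (sym (out₀ φ glue a))
                      (trans (sym (in₀ φ glue a)) (in′ φ glue (a ↑ˡ m)))) }
    ; g∘f     = λ { (inj₁ i) φ glue → sym (in′ φ glue i)
                  ; (inj₂ (inj₁ (inj₁ a))) φ glue → trans (sym (in′ φ glue (a ↑ˡ m))) (in₀ φ glue a)
                  ; (inj₂ (inj₁ (inj₂ y))) φ glue → refl
                  ; (inj₂ (inj₂ j)) φ glue → out φ glue j }
    ; f∘g     = λ y φ _ → refl
    ; ef      = λ { (inj₂ (inj₁ (inj₂ e))) → e }
    ; eg      = λ e → inj₂ (inj₁ (inj₂ e))
    ; eg∘ef   = λ { (inj₂ (inj₁ (inj₂ e))) → refl }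
    ; ef∘eg   = λ _ → refl
    ; f-lab   = λ { (inj₂ (inj₁ (inj₂ e))) → refl }
    ; f-src   = λ { (inj₂ (inj₁ (inj₂ e))) → unwrap (src R e) }
    ; f-tgt   = λ { (inj₂ (inj₁ (inj₂ e))) → unwrap (tgt R e) }
    ; f-left  = λ i φ _ → refl
    ; f-right = λ i φ _ → refl
    }
    where
    A = wires {m = m} (x ↑ʳ_) ((_↑ˡ m) ▿ idᶠ)
    B = wires {x} idᶠ idᶠ ⊗ᴿ R
    C = wires {n = n} ((_↑ˡ n) ▿ idᶠ) (x ↑ʳ_)
    rA = r A
    lB = l B
    rB = r B
    lC = l C

    f : W (A ⨾ᴿ B ⨾ᴿ C) → W R
    f (inj₁ i)               = l R i
    -- The straight wire goes to input `a`: the pairs at the cup are then respected on the nose, and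
    -- those at the cap use the pair added by `traceᴿ`.
    f (inj₂ (inj₁ (inj₁ a))) = l R (a ↑ˡ m)
    f (inj₂ (inj₁ (inj₂ y))) = y
    f (inj₂ (inj₂ j))        = r R j

    w : W R → W (A ⨾ᴿ B ⨾ᴿ C)
    w y = inj₂ (inj₁ (inj₂ y))

    unwrap : ∀ ys → ys ≡ map f (map inj₂ (map inj₁ (map inj₂ ys)))
    unwrap []       = refl
    unwrap (y ∷ ys) = cong (y ∷_) (unwrap ys)

    module _ {D : Set} (φ : W (A ⨾ᴿ B ⨾ᴿ C) → D) (glue : Glues (A ⨾ᴿ B ⨾ᴿ C) φ) where
      in₀ : ∀ a → φ (inj₁ (a ↑ˡ m)) ≡ φ (inj₂ (inj₁ (inj₁ a)))
      in₀ a = trans (cong (φ ∘ inj₁) (sym (▿-ˡ {x} (_↑ˡ m) idᶠ a)))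
        (trans (glue (inj₂ (a ↑ˡ (x + m)))) (cong (φ ∘ inj₂ ∘ inj₁) (▿-ˡ {x} (inj₁ ∘ idᶠ) (inj₂ ∘ l R) a)))

      in′ : ∀ i → φ (inj₁ i) ≡ φ (w (l R i))
      in′ i = trans (cong (φ ∘ inj₁) (sym (▿-ʳ {x} (_↑ˡ m) idᶠ i)))
        (trans (glue (inj₂ (x ↑ʳ i))) (cong (φ ∘ inj₂ ∘ inj₁) (▿-ʳ {x} (inj₁ ∘ idᶠ) (inj₂ ∘ l R) i)))

      out₀ : ∀ a → φ (inj₂ (inj₁ (inj₁ a))) ≡ φ (inj₂ (inj₂ (a ↑ˡ n)))
      out₀ a = trans (cong (φ ∘ inj₂ ∘ inj₁) (sym (▿-ˡ {x} (inj₁ ∘ idᶠ) (inj₂ ∘ r R) a)))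
        (trans (glue (inj₁ (inj₂ (inj₂ (a ↑ˡ (x + n)))))) (cong (φ ∘ inj₂ ∘ inj₂) (▿-ˡ {x} (_↑ˡ n) idᶠ a)))

      out : ∀ j → φ (w (r R j)) ≡ φ (inj₂ (inj₂ j))
      out j = trans (cong (φ ∘ inj₂ ∘ inj₁) (sym (▿-ʳ {x} (inj₁ ∘ idᶠ) (inj₂ ∘ r R) j)))
        (trans (glue (inj₁ (inj₂ (inj₂ (x ↑ʳ j))))) (cong (φ ∘ inj₂ ∘ inj₂) (▿-ʳ {x} (_↑ˡ n) idᶠ j)))

  trace-⊨ : ∀ x {m n} {t : STerm (x + m) (x + n)} {R} → t ⊨ R → canonicalTrace x t ⊨ traceᴿ x R
  trace-⊨ x {m} {n} {R = R} T = ⊨-resp-≃ (trace-≃ x R)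
    (⨾-⊨ (⊨-wires (λ _ → refl) (codiagonal-⊞ x m)
            (castʳ-⊨ (+-assoc x x m) (⊗-⊨-wires (cup-⊨ x) (id-⊨ m))))
    (⨾-⊨ (⊗-⊨ (id-⊨ x) T)
         (⊨-wires (codiagonal-⊞ x n) (λ _ → refl)
            (castˡ-⊨ (+-assoc x x n) (⊗-⊨-wires (cap-⊨ x) (id-⊨ n))))))

  -- Joint injectivity and its preservation.

  -- Jointly, the left leg and the target positions name each vertex at most
  -- once; for raw c this is partial left-monogamy.
  record Injective {m n} (R : Raw m n) : Set where
    field
      l-injective   : ∀ {i j} → l R i ≡ l R j → i ≡ j
      l-not-target  : ∀ {e k w} → At (tgt R e) k w → ∀ i → l R i ≢ w
      tgt-injective : ∀ {e e′ k k′ w} → At (tgt R e) k w → At (tgt R e′) k′ w → e ≡ e′ × k ≡ k′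

  -- `h` is constant on classes and fixes every named vertex, so named vertices with equal images
  -- under `q` were already equal.
  Injective-quotient : ∀ {m n} {c : Cospan m n} {R} → c ⊩ R → (h : W R → W R) → Glues R h →
    (∀ i → h (l R i) ≡ l R i) → (∀ {e k w} → At (tgt R e) k w → h w ≡ w) →
    Injective R → Injective (raw c)
  Injective-quotient {c = c} {R} C h glue fix-l fix-tgt I = record
    { l-injective   = λ {i} {j} eq → I.l-injective
        (lift (fix-l i) (fix-l j) (trans (sym (left-leg i)) (trans eq (left-leg j))))
    ; l-not-target  = λ p i eq → let w , at , qw = target _ p in
        I.l-not-target at i (lift (fix-l i) (fix-tgt at) (trans (sym (left-leg i)) (trans eq (sym qw))))
    ; tgt-injective = λ p p′ →
        let w  , at  , qw  = target _ p
            w′ , at′ , qw′ = target _ p′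
            ww′ = lift (fix-tgt at′) (fix-tgt at) (trans qw′ (sym qw))
            ee′ , kk′ = I.tgt-injective at (subst (At _ _) ww′ at′)
        in trans (sym (edge-edge⁻¹ _)) (trans (cong edge ee′) (edge-edge⁻¹ _)) , kk′
    }
    where
    module I = Injective I
    open _⊩_ C

    lift : ∀ {x y} → h x ≡ x → h y ≡ y → q x ≡ q y → x ≡ y
    lift {x} {y} hx hy eq = trans (sym hx) (trans (sym (rep-q x h glue))
      (trans (cong (h ∘ rep) eq) (trans (rep-q y h glue) hy)))

    target : ∀ e {k w} → At (toList (targets (apex c) e)) k w →
             ∃ λ x → At (tgt R (edge⁻¹ e)) k x × q x ≡ w
    target e p = At-map⁻ _ (subst (λ ys → At ys _ _)
      (trans (cong (toList ∘ targets (apex c)) (sym (edge-edge⁻¹ e))) (targets-edge (edge⁻¹ e))) p)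

  module _ {m n p q} {R : Raw m n} {S : Raw p q} (I : Injective R) (J : Injective S) where
    private
      module I = Injective I
      module J = Injective J

      tgts : E R ⊎ E S → List (W R ⊎ W S)
      tgts = [ map inj₁ ∘ tgt R , map inj₂ ∘ tgt S ]′

      tgts-injective : ∀ e e′ {k k′ w} → At (tgts e) k w → At (tgts e′) k′ w → e ≡ e′ × k ≡ k′
      tgts-injective (inj₁ e) (inj₁ e′) p p′ with At-map⁻ _ p | At-map⁻ _ p′
      ... | x , at , refl | x′ , at′ , refl = let eq , kk′ = I.tgt-injective at at′ in cong inj₁ eq , kk′
      tgts-injective (inj₁ e) (inj₂ e′) p p′ with At-map⁻ _ p | At-map⁻ _ p′
      ... | x , at , refl | x′ , at′ , ()
      tgts-injective (inj₂ e) (inj₁ e′) p p′ with At-map⁻ _ p | At-map⁻ _ p′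
      ... | x , at , refl | x′ , at′ , ()
      tgts-injective (inj₂ e) (inj₂ e′) p p′ with At-map⁻ _ p | At-map⁻ _ p′
      ... | x , at , refl | x′ , at′ , refl = let eq , kk′ = J.tgt-injective at at′ in cong inj₂ eq , kk′

      l-avoids-tgts : ∀ e {k w} → At (tgts e) k w →
                      (∀ i → inj₁ (l R i) ≢ w) × (∀ i → inj₂ (l S i) ≢ w)
      l-avoids-tgts (inj₁ e) p with At-map⁻ _ p
      ... | x , at , refl = (λ i eq → I.l-not-target at i (inj₁-injective eq)) , λ i ()
      l-avoids-tgts (inj₂ e) p with At-map⁻ _ p
      ... | x , at , refl = (λ i ()) , λ i eq → J.l-not-target at i (inj₂-injective eq)

    Injective-⊗ : Injective (R ⊗ᴿ S)
    Injective-⊗ = record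
      { l-injective   = ▿-injective (I.l-injective ∘ inj₁-injective) (J.l-injective ∘ inj₂-injective) (λ i j ())
      ; l-not-target  = λ {e} p → let a , b = l-avoids-tgts e p in ▿-avoids a b
      ; tgt-injective = λ {e} {e′} → tgts-injective e e′
      }

  -- The names of the composite are among those of the tensor; only the inputs of `S` cease to be
  -- names.
  Injective-⨾ : ∀ {m n p} {R : Raw m n} {S : Raw n p} → Injective R → Injective S → Injective (R ⨾ᴿ S)
  Injective-⨾ {m} I J = record
    { l-injective   = λ eq → I.l-injective (inj₁-injective eq)
    ; l-not-target  = λ {e} p i eq → I⊗J.l-not-target {e} p (i ↑ˡ _) (trans (▿-ˡ _ _ i) eq)
    ; tgt-injective = λ {e} {e′} → I⊗J.tgt-injective {e} {e′}
    }
    where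
    module I   = Injective I
    module I⊗J = Injective (Injective-⊗ I J)

  -- The inputs of `d` are pairwise distinct and differ from the inputs of `c` and from all targets,
  -- so redirecting them to the outputs of `c` fixes every remaining name.
  Injective-raw-⨾ : ∀ {m n p} {c : Cospan m n} {d : Cospan n p} →
                    Injective (raw c) → Injective (raw d) → Injective (raw (c ⨾ᶜ d))
  Injective-raw-⨾ {m} {c = c} {d} I J =
    Injective-quotient (⨾-⊩ (⊩-raw c) (⊩-raw d)) h
      (λ { (inj₁ (inj₁ ())) ; (inj₁ (inj₂ ())) ; (inj₂ j) → h-glue j })
      (λ i → h-fix _ (λ j ()))
      (λ {e} p → h-fix _ (λ j eq → I⊗J.l-not-target {e} p (m ↑ʳ j) (trans (▿-ʳ {m} (inj₁ ∘ vmap (left c)) (inj₂ ∘ vmap (left d)) j) eq)))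
      (Injective-⨾ I J)
    where
    module J   = Injective J
    module I⊗J = Injective (Injective-⊗ I J)
    redirected = redirect (≡-dec _≟_ _≟_) _ (inj₁ ∘ vmap (right c)) (inj₂ ∘ vmap (left d))
                          (J.l-injective ∘ inj₂-injective)
    h      = proj₁ redirected
    h-glue = proj₁ (proj₂ redirected)
    h-fix  = proj₂ (proj₂ redirected)

  -- The traced inputs are the ones redirected. `d` is any cospan so presented, whence
  -- `canonicalTrace` enters only through `trace-⊨`.
  Injective-traceᴿ : ∀ x {m n} {c : Cospan (x + m) (x + n)} {d : Cospan m n} → d ⊩ traceᴿ x (raw c) →
                     Injective (raw c) → Injective (raw d)
  Injective-traceᴿ x {m} {n} {c} D I = Injective-quotient D h
    (λ { (inj₁ ()) ; (inj₂ a) → h-glue a })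
    (λ i → h-fix _ (λ a eq → ↑ˡ≢↑ʳ a i (I.l-injective eq)))
    (λ p → h-fix _ (λ a → I.l-not-target p (a ↑ˡ m)))
    (record { l-injective   = λ eq → ↑ʳ-injective x _ _ (I.l-injective eq)
            ; l-not-target  = λ p i → I.l-not-target p (x ↑ʳ i)
            ; tgt-injective = I.tgt-injective })
    where
    module I = Injective I
    redirected = redirect _≟_ x (λ a → vmap (right c) (a ↑ˡ n)) (λ a → vmap (left c) (a ↑ˡ m))
                          (λ eq → ↑ˡ-injective m _ _ (I.l-injective eq))
    h      = proj₁ redirected
    h-glue = proj₁ (proj₂ redirected)
    h-fix  = proj₂ (proj₂ redirected)

  Injective-edgeless : ∀ {a m n} {f : Fin m → Fin a} {g : Fin n → Fin a} →
                       (∀ {i j} → f i ≡ f j → i ≡ j) → Injective (wires f g)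
  Injective-edgeless f-inj = record
    { l-injective = f-inj ; l-not-target = λ { {()} } ; tgt-injective = λ { {()} } }

  Injective-gen : ∀ φ → Injective (raw (genᶜ φ))
  Injective-gen φ = record
    { l-injective   = λ eq → ↑ˡ-injective (cod φ) _ _ eq
    ; l-not-target  = λ p i eq → let j , _ , eq′ = At-tabulate⁻ (dom φ ↑ʳ_) p in
                                 ↑ˡ≢↑ʳ i j (trans eq (sym eq′))
    ; tgt-injective = λ { {zero} {zero} p p′ →
        let j  , jk  , eq  = At-tabulate⁻ (dom φ ↑ʳ_) p
            j′ , jk′ , eq′ = At-tabulate⁻ (dom φ ↑ʳ_) p′
        in refl , trans (sym jk) (trans (cong toℕ (↑ʳ-injective (dom φ) j j′ (trans eq (sym eq′)))) jk′) }
    }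

  image-Injective : ∀ {m n} (t : TTerm m n) → Injective (raw ⟪ ⌊ t ⌋ ⟫)
  image-Injective (gen φ)  = Injective-gen φ
  image-Injective δ        = Injective-edgeless λ { {zero} {zero} _ → refl }
  image-Injective ε        = Injective-edgeless λ { {zero} {zero} _ → refl }
  image-Injective (id n)   = Injective-edgeless (λ eq → eq)
  image-Injective (s ⨾ t)  = Injective-raw-⨾ {c = ⟪ ⌊ s ⌋ ⟫} {⟪ ⌊ t ⌋ ⟫} (image-Injective s) (image-Injective t)
  image-Injective (s ⊗ t)  = Injective-quotient (⊗-⊩ (⊩-raw ⟪ ⌊ s ⌋ ⟫) (⊩-raw ⟪ ⌊ t ⌋ ⟫)) (λ w → w)
    (λ { (inj₁ ()) ; (inj₂ ()) }) (λ _ → refl) (λ _ → refl)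
    (Injective-⊗ (image-Injective s) (image-Injective t))
  image-Injective (σ m n)  = Injective-edgeless (λ eq → eq)
  image-Injective (tr x t) = Injective-traceᴿ x {c = ⟪ ⌊ t ⌋ ⟫} (presents (trace-⊨ x (⊨-raw ⌊ t ⌋))) (image-Injective t)

  -- Joint injectivity versus degrees.

  module _ {m n} (c : Cospan m n) where
    private
      F = apex c

      indegree : Fin (vertices F) → Fin (edges F) → ℕ
      indegree v e = count (v ≟_) (targets F e)

      At⇒indegree≢0 : ∀ {v e k} → At (toList (targets F e)) k v → indegree v e ≢ 0
      At⇒indegree≢0 {v} {e} p eq = count≡0⇒¬At v (targets F e) eq p

      left? : ∀ v → Dec (∃[ i ] vmap (left c) i ≡ v)
      left? v = any? (λ i → vmap (left c) i ≟ v)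

    -- In-degree 0 on the image of the left leg keeps inputs apart from targets; in-degree at most 1
    -- everywhere excludes a second target position, be it on another hyperedge or on the same one.
    PartialLeftMonogamous⇒Injective : PartialLeftMonogamous c → Injective (raw c)
    PartialLeftMonogamous⇒Injective M = record
      { l-injective   = λ {i} {j} eq →
          proj₁ (left-mono (point i) (point j) ((λ _ → eq) , λ ())) zero
      ; l-not-target  = λ {e} {k} {v} p i eq →
          At⇒indegree≢0 p (sum≡0⇒≡0 (indegree v) (cong proj₁ (proj₂ (inImage v (i , eq)))) e)
      ; tgt-injective = λ {e} {e′} {k} {k′} {v} p p′ →
          let ee′ = sum≤1⇒unique (indegree v) (degree≤1 v) (At⇒indegree≢0 p) (At⇒indegree≢0 p′)
          in ee′ , same-edge ee′ p p′
      }
      where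
      open PartialLeftMonogamous M

      -- Monicity is tested on maps out of a single vertex.
      point : Fin m → discrete 1 ⇒ discrete m
      point i = fromDiscrete (λ _ → i)

      degree≤1 : ∀ v → proj₁ (degree F v) ≤ 1
      degree≤1 v with left? v
      ... | yes p = subst (_≤ 1) (cong proj₁ (sym (proj₂ (inImage v p)))) z≤n
      ... | no ¬p with notInImage v ¬p
      ...   | o , inj₁ eq = subst (_≤ 1) (cong proj₁ (sym eq)) z≤n
      ...   | o , inj₂ eq = subst (_≤ 1) (cong proj₁ (sym eq)) ≤-refl

      same-edge : ∀ {v e e′ k k′} → e ≡ e′ → At (toList (targets F e)) k v → At (toList (targets F e′)) k′ v → k ≡ k′
      same-edge {v} {e} refl = count≤1⇒At-unique v (targets F e) (≤-trans (≤sum (indegree v) e) (degree≤1 v))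

    Injective⇒PartialLeftMonogamous : Injective (raw c) → PartialLeftMonogamous c
    Injective⇒PartialLeftMonogamous I = record
      -- A hypergraph mapping to a discrete one has no hyperedges, so only vertices are to be
      -- compared.
      { left-mono  = λ j k eq → (λ v → l-injective (proj₁ eq v)) , (λ e → case emap j e of λ ())
      ; inImage    = λ { v (i , eq) → _ , cong (_, proj₂ (degree F v)) (≡0⇒sum≡0 (indegree v)
          (λ e → ¬At⇒count≡0 v (targets F e) (λ p → l-not-target p i eq))) }
      ; notInImage = λ v _ → _ , at-most-one _ (unique⇒sum≤1 (indegree v)
          (λ e → At-unique⇒count≤1 v (targets F e) (λ p p′ → proj₂ (tgt-injective p p′)))
          (λ p p′ → proj₁ (tgt-injective (proj₂ (count≢0⇒At v _ p)) (proj₂ (count≢0⇒At v _ p′)))))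
      }
      where
      open Injective I

      at-most-one : ∀ d {o} → d ≤ 1 → (d , o) ≡ (0 , o) ⊎ (d , o) ≡ (1 , o)
      at-most-one zero    _         = inj₁ refl
      at-most-one (suc 0) _         = inj₂ refl
      at-most-one (suc (suc _)) (s≤s ())

  -- Realising cospans without hyperedges.

  discard : ∀ a → TTerm a 0
  discard zero    = id 0
  discard (suc a) = ε ⊗ discard a

  discard-⊨ : ∀ a → ⌊ discard a ⌋ ⊨ wires idᶠ ¡
  discard-⊨ a = subst (_⊨ wires idᶠ ¡) (sym (⌊discard⌋ a)) (εs-⊨ a)
    where
    ⌊discard⌋ : ∀ a → ⌊ discard a ⌋ ≡ εs a
    ⌊discard⌋ zero    = refl
    ⌊discard⌋ (suc a) = cong (ε ⊗_) (⌊discard⌋ a)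

  -- The new copy of wire `i` is brought to the front, and all wires continue in their order behind
  -- it.
  copy : ∀ {a} → Fin a → TTerm a (suc a)
  copy {suc a} zero    = δ ⊗ id a
  copy {suc a} (suc i) = (id 1 ⊗ copy i) ⨾ (σ 1 1 ⊗ id a)

  copy-⊨ : ∀ {a} (i : Fin a) → ⌊ copy i ⌋ ⊨ wires idᶠ ((λ (_ : Fin 1) → i) ▿ idᶠ)
  copy-⊨ {suc a} zero    = ⊨-wires (λ { zero → refl ; (suc _) → refl })
    (λ { zero → refl ; (suc zero) → refl ; (suc (suc _)) → refl })
    (⊗-⊨-wires (⊨-raw δ) (id-⊨ a))
  copy-⊨ {suc a} (suc i) = ⊨-wires (⊞-cong-id {1} (λ _ → refl) (λ _ → refl))
    (λ { zero → refl ; (suc zero) → refl ; (suc (suc _)) → refl })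
    (⨾-⊨-wires (⊗-⊨-wires (id-⊨ 1) (copy-⊨ i))
      (⊨-wires (⊞-cong-id {2} (λ _ → refl) (λ _ → refl)) (λ _ → refl) (⊗-⊨-wires (σ-⊨ 1 1) (id-⊨ a))))

  -- Comonoid terms realise every function of finite sets, read backwards: each output is copied
  -- from the input it names, and at the end all inputs are discarded.
  connect : ∀ {a} b → (Fin b → Fin a) → TTerm a b
  connect {a} zero f = discard a
  connect (suc b)  f = copy (f zero) ⨾ (id 1 ⊗ connect b (f ∘ suc))

  connect-⊨ : ∀ {a} b (f : Fin b → Fin a) → ⌊ connect b f ⌋ ⊨ wires idᶠ f
  connect-⊨ {a} zero f = ⊨-wires (λ _ → refl) (λ ()) (discard-⊨ a)
  connect-⊨ (suc b)  f = ⊨-wires (λ _ → refl) (λ { zero → refl ; (suc _) → refl })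
    (⨾-⊨-wires (copy-⊨ (f zero))
      (⊨-wires (⊞-cong-id {1} (λ _ → refl) (λ _ → refl)) (λ _ → refl)
        (⊗-⊨-wires (id-⊨ 1) (connect-⊨ b (f ∘ suc)))))

  -- Every vertex is a traced wire, fed by the input that names it if there is
  -- one and by itself otherwise.
  edgeless-realised : ∀ (F : Hypergraph) → edges F ≡ 0 → ∀ {m n}
    (f : Fin m → Fin (vertices F)) (g : Fin n → Fin (vertices F)) → (∀ {i j} → f i ≡ f j → i ≡ j) →
    ∃ λ t → ⌊ t ⌋ ⊨ rawOf F f g
  edgeless-realised F refl {m} {n} f g f-inj =
    tr V (connect (V + n) wiring) , ⊨-resp-≃ record
      { f       = f′
      ; g       = _↑ˡ m
      ; f-glue  = λ { (inj₁ ()) ; (inj₂ w) φ _ → cong φ (trans (cong f′ (▿-ˡ feed (λ j → g j ↑ˡ m) w))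
                        (trans (f′-feed w) (sym (▿-ˡ idᶠ f w)))) }
      ; g-glue  = λ ()
      ; g∘f     = λ x φ glue → +-elim V (λ x → φ (f′ x ↑ˡ m) ≡ φ x)
          (λ w → cong (λ y → φ (y ↑ˡ m)) (▿-ˡ idᶠ f w))
          -- Input `i` is identified with the traced wire `f i` by the pair at that wire, where
          -- `feed` can only choose `i` because `f` is injective.
          (λ i → trans (cong (λ y → φ (y ↑ˡ m)) (▿-ʳ idᶠ f i))
            (trans (sym (glue (inj₂ (f i))))
              (cong φ (trans (▿-ˡ feed (λ j → g j ↑ˡ m) (f i)) (feed-f i))))) x
      ; f∘g     = λ w φ _ → cong φ (▿-ˡ idᶠ f w)
      ; ef      = λ ()
      ; eg      = λ ()
      ; eg∘ef   = λ ()
      ; ef∘eg   = λ ()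
      ; f-lab   = λ ()
      ; f-src   = λ ()
      ; f-tgt   = λ ()
      ; f-left  = λ i φ _ → cong φ (▿-ʳ idᶠ f i)
      ; f-right = λ j φ _ → cong φ (trans (cong f′ (▿-ʳ feed (λ j → g j ↑ˡ m) j)) (▿-ˡ idᶠ f (g j)))
      } (trace-⊨ V (connect-⊨ (V + n) wiring))
    where
    V = vertices F

    input? : ∀ w → Dec (∃[ i ] f i ≡ w)
    input? w = any? (λ i → f i ≟ w)

    feed : Fin V → Fin (V + m)
    feed w with input? w
    ... | yes (i , _) = V ↑ʳ i
    ... | no  _       = w ↑ˡ m

    wiring : Fin (V + n) → Fin (V + m)
    wiring = feed ▿ (λ j → g j ↑ˡ m)

    f′ : Fin (V + m) → Fin V
    f′ = idᶠ ▿ f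

    f′-feed : ∀ w → f′ (feed w) ≡ w
    f′-feed w with input? w
    ... | yes (i , eq) = trans (▿-ʳ idᶠ f i) eq
    ... | no  _        = ▿-ˡ idᶠ f w

    feed-f : ∀ i → feed (f i) ≡ V ↑ʳ i
    feed-f i with input? (f i)
    ... | yes (j , eq) = cong (V ↑ʳ_) (f-inj eq)
    ... | no  ¬p       = contradiction (i , refl) ¬p

  -- Invariance under isomorphism.

  -- Makes invariance of `Injective` an instance of `Injective-quotient` with nothing redirected.
  ≅⇒⊩ : ∀ {m n} {c d : Cospan m n} → c ≅ d → d ⊩ raw c
  ≅⇒⊩ {c = c} {d} p = record
    { q = vmap to ; q-glue = λ () ; rep = vmap from
    ; q-rep = proj₁ to∘from ; rep-q = λ x h _ → cong h (proj₁ from∘to x)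
    ; edge = emap to ; edge⁻¹ = emap from
    ; edge-edge⁻¹ = proj₂ to∘from ; edge⁻¹-edge = proj₂ from∘to
    ; label-edge = pres-label to ; sources-edge = pres-sources to ; targets-edge = pres-targets to
    ; left-leg  = λ i → sym (proj₁ to∘left i)
    ; right-leg = λ i → sym (proj₁ to∘right i) }
    where open _≅_ p

  Injective-resp-≅ : ∀ {m n} {c d : Cospan m n} → c ≅ d → Injective (raw c) → Injective (raw d)
  Injective-resp-≅ p = Injective-quotient (≅⇒⊩ p) (λ w → w) (λ ()) (λ _ → refl) (λ _ → refl)

  -- Splitting off one hyperedge and plugging it back.

  module _ {V E} (lab₀ : Fin (suc E) → Gen)
           (src₀ : ∀ e → Vec (Fin V) (dom (lab₀ e))) (tgt₀ : ∀ e → Vec (Fin V) (cod (lab₀ e))) where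

    withEdges withoutFirst : Hypergraph
    withEdges    = record { vertices = V ; edges = suc E ; label = lab₀ ; sources = src₀ ; targets = tgt₀ }
    withoutFirst = record { vertices = V ; edges = E ; label = lab₀ ∘ suc
                          ; sources = λ e → src₀ (suc e) ; targets = λ e → tgt₀ (suc e) }

    private
      φ = lab₀ zero

      s : Fin (dom φ) → Fin V
      s = Vec.lookup (src₀ zero)

      t : Fin (cod φ) → Fin V
      t = Vec.lookup (tgt₀ zero)

    module _ {m n} (f : Fin m → Fin V) (g : Fin n → Fin V) where

      -- The names are only regrouped: the targets of the removed hyperedge turn from target
      -- positions into inputs.
      Injective-withoutFirst : Injective (rawOf withEdges f g) → Injective (rawOf withoutFirst (t ▿ f) (s ▿ g))
      Injective-withoutFirst I = record
        { l-injective   = ▿-injective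
            (λ {i} {j} eq → toℕ-injective (proj₂ (tgt-injective {zero} {zero}
               (At-lookup (tgt₀ zero) i) (subst (At _ _) (sym eq) (At-lookup (tgt₀ zero) j)))))
            l-injective
            (λ i j eq → l-not-target {zero} (At-lookup (tgt₀ zero) i) j (sym eq))
        ; l-not-target  = λ {e} p → ▿-avoids
            (λ i eq → 0≢1+n (proj₁ (tgt-injective {zero} {suc e} (subst (At _ _) eq (At-lookup (tgt₀ zero) i)) p)))
            (l-not-target {suc e} p)
        ; tgt-injective = λ {e} {e′} p p′ →
            let ee′ , kk′ = tgt-injective {suc e} {suc e′} p p′ in suc-injective ee′ , kk′
        }
        where open Injective I

      -- Composition glues the sources of the fresh generator to the vertices `s`, and the trace
      -- glues its targets to the vertices `t`. Every added vertex is thus identified with an old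
      -- one, and the generator takes the place of the removed hyperedge.
      plug-≃ : traceᴿ (cod φ) (rawOf withoutFirst (t ▿ f) (s ▿ g) ⨾ᴿ (raw (genᶜ φ) ⊗ᴿ wires idᶠ idᶠ))
               ≃ rawOf withEdges f g
      plug-≃ = record
        { f       = h
        ; g       = inj₁
        ; f-glue  = λ
            { (inj₁ (inj₁ (inj₁ ())))
            ; (inj₁ (inj₁ (inj₂ (inj₁ ()))))
            ; (inj₁ (inj₁ (inj₂ (inj₂ ()))))
            ; (inj₁ (inj₂ j)) ψ _ → cong ψ (+-elim (dom φ) (λ j → (s ▿ g) j ≡ h (inj₂ (inputs j)))
                (λ i → trans (▿-ˡ s g i) (sym (trans (cong (h ∘ inj₂) (inputs-s i)) (▿-ˡ s t i))))
                (λ i → trans (▿-ʳ s g i) (sym (cong (h ∘ inj₂) (inputs-g i)))) j)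
            ; (inj₂ a) ψ _ → cong ψ (trans (cong (h ∘ inj₂) (outputs-t a))
                (trans (▿-ʳ s t a) (sym (▿-ˡ t f a)))) }
        ; g-glue  = λ ()
        ; g∘f     = λ
            { (inj₁ w) ψ _ → refl
            ; (inj₂ (inj₁ y)) ψ glue → +-elim (dom φ) (λ y → ψ (inj₁ ((s ▿ t) y)) ≡ ψ (inj₂ (inj₁ y)))
                (λ i → trans (cong (ψ ∘ inj₁) (trans (▿-ˡ s t i) (sym (▿-ˡ s g i))))
                  (trans (glue (inj₁ (inj₂ (i ↑ˡ n)))) (cong (ψ ∘ inj₂) (inputs-s i))))
                (λ a → trans (cong (ψ ∘ inj₁) (trans (▿-ʳ s t a) (sym (▿-ˡ t f a))))
                  (trans (sym (glue (inj₂ a))) (cong (ψ ∘ inj₂) (outputs-t a)))) y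
            ; (inj₂ (inj₂ j)) ψ glue → trans (cong (ψ ∘ inj₁) (sym (▿-ʳ s g j)))
                (trans (glue (inj₁ (inj₂ (dom φ ↑ʳ j)))) (cong (ψ ∘ inj₂) (inputs-g j))) }
        ; f∘g     = λ _ _ _ → refl
        ; ef      = λ { (inj₁ e) → suc e ; (inj₂ (inj₁ zero)) → zero }
        ; eg      = λ { zero → inj₂ (inj₁ zero) ; (suc e) → inj₁ e }
        ; eg∘ef   = λ { (inj₁ e) → refl ; (inj₂ (inj₁ zero)) → refl }
        ; ef∘eg   = λ { zero → refl ; (suc e) → refl }
        ; f-lab   = λ { (inj₁ e) → refl ; (inj₂ (inj₁ zero)) → refl }
        ; f-src   = λ { (inj₁ e) → unwrap (toList (src₀ (suc e)))
                      ; (inj₂ (inj₁ zero)) → ends (src₀ zero) (_↑ˡ cod φ) (▿-ˡ s t) }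
        ; f-tgt   = λ { (inj₁ e) → unwrap (toList (tgt₀ (suc e)))
                      ; (inj₂ (inj₁ zero)) → ends (tgt₀ zero) (dom φ ↑ʳ_) (▿-ʳ s t) }
        ; f-left  = λ i ψ _ → cong ψ (▿-ʳ t f i)
        ; f-right = λ j ψ _ → cong (ψ ∘ h ∘ inj₂) (▿-ʳ (inj₁ ∘ (dom φ ↑ʳ_)) (inj₂ ∘ idᶠ {n}) j)
        }
        where
        W′ = Fin (dom φ + cod φ) ⊎ Fin n

        h : Fin V ⊎ W′ → Fin V
        h (inj₁ w)        = w
        h (inj₂ (inj₁ y)) = (s ▿ t) y
        h (inj₂ (inj₂ j)) = g j

        inputs : Fin (dom φ + n) → W′
        inputs = (inj₁ ∘ (_↑ˡ cod φ)) ▿ (inj₂ ∘ idᶠ)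

        inputs-s : ∀ i → inputs (i ↑ˡ n) ≡ inj₁ (i ↑ˡ cod φ)
        inputs-s = ▿-ˡ (inj₁ ∘ (_↑ˡ cod φ)) (inj₂ ∘ idᶠ)

        inputs-g : ∀ j → inputs (dom φ ↑ʳ j) ≡ inj₂ j
        inputs-g = ▿-ʳ (inj₁ ∘ (_↑ˡ cod φ)) (inj₂ ∘ idᶠ)

        outputs-t : ∀ a → ((inj₁ ∘ (dom φ ↑ʳ_)) ▿ (inj₂ ∘ idᶠ)) (a ↑ˡ n) ≡ inj₁ (dom φ ↑ʳ a)
        outputs-t = ▿-ˡ (inj₁ ∘ (dom φ ↑ʳ_)) (inj₂ ∘ idᶠ)

        unwrap : ∀ ws → ws ≡ map h (map inj₁ ws)
        unwrap ws = trans (sym (map-id ws)) (map-∘ ws)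

        ends : ∀ {k} (xs : Vec (Fin V) k) (at : Fin k → Fin (dom φ + cod φ)) →
               (∀ i → (s ▿ t) (at i) ≡ Vec.lookup xs i) →
               toList xs ≡ map h (map inj₂ (map inj₁ (toList (tabulate at))))
        ends []       at p = refl
        ends (x ∷ xs) at p = cong₂ _∷_ (sym (p zero)) (ends xs (at ∘ suc) (p ∘ suc))

  -- The fields of the hypergraph are separate arguments so that the recursion can run on the number
  -- of hyperedges.
  realise : ∀ E {V m n} (lab₀ : Fin E → Gen)
    (src₀ : ∀ e → Vec (Fin V) (dom (lab₀ e))) (tgt₀ : ∀ e → Vec (Fin V) (cod (lab₀ e)))
    (f : Fin m → Fin V) (g : Fin n → Fin V) →
    let F = record { vertices = V ; edges = E ; label = lab₀ ; sources = src₀ ; targets = tgt₀ } in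
    Injective (rawOf F f g) → ∃ λ t → ⌊ t ⌋ ⊨ rawOf F f g
  realise zero lab₀ src₀ tgt₀ f g I =
    edgeless-realised _ refl f g (Injective.l-injective I)
  realise (suc E) {n = n} lab₀ src₀ tgt₀ f g I =
    let t , T = realise E (lab₀ ∘ suc) (λ e → src₀ (suc e)) (λ e → tgt₀ (suc e))
                  (Vec.lookup (tgt₀ zero) ▿ f) (Vec.lookup (src₀ zero) ▿ g)
                  (Injective-withoutFirst lab₀ src₀ tgt₀ f g I)
        φ = lab₀ zero
    -- The outputs of `t` begin with the sources of the removed hyperedge, which feed `gen φ`; its
    -- results are traced into the leading inputs of `t`, the former targets.
    in tr (cod φ) (t ⨾ (gen φ ⊗ id n))
     , ⊨-resp-≃ (plug-≃ lab₀ src₀ tgt₀ f g)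
         (trace-⊨ (cod φ) (⨾-⊨ T (⊗-⊨ (⊨-raw (gen φ)) (id-⊨ n))))

  realised : ∀ {m n} (c : Cospan m n) → Injective (raw c) → ∃ λ t → ⟪ ⌊ t ⌋ ⟫ ≅ c
  realised c I =
    let t , T = realise (edges F) (label F) (sources F) (targets F) (vmap (left c)) (vmap (right c)) I
    in t , ⊩-unique (presents T) (⊩-raw c)
    where F = apex c

theorem8p138 : (𝕊 : Signature) → let open Over 𝕊 in
    (m n : ℕ) (c : Setoid.Carrier (Csp m n)) →
    (∃ λ (t : Setoid.Carrier (T+CComon m n)) → Setoid._≈_ (Csp m n) ⟪ ⌊ t ⌋ ⟫ c) ⇔ PartialLeftMonogamous c
theorem8p138 𝕊 m n c = mk⇔
  (λ { (t , t≅c) → Injective⇒PartialLeftMonogamous c (Injective-resp-≅ t≅c (image-Injective t)) })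
  (realised c ∘ PartialLeftMonogamous⇒Injective c)
  where open Presentations 𝕊
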